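{- Let $T=\{2341,2413,3412\}$ and let $F=F_T(x)=\sum_{n\ge0}|S_n(T)|x^n$. Then $F$ satisfies $$F=(1-x)^2+xF+x(2-3x+2x^2)F^2-x^2(1-x)F^3.$$
   Context: $S_n$ is the set of permutations of $[n]$ ($S_0$ contains the empty permutation). A permutation avoids a pattern $\tau$ if it has no subsequence order-isomorphic to $\tau$; $S_n(T)$ is the set of permutations in $S_n$ avoiding every pattern in $T$. -}

module Defs where

open import Data.Bool using (Bool; true; false; _∧_; _∨_; not; if_then_else_)
open import Data.Nat as ℕ using (ℕ; zero; suc; _<ᵇ_; _≡ᵇ_)
open import Data.Integer as ℤ using (ℤ; +_; -_; _-_)
open import Data.List using (List; []; _∷_; map; concatMap; upTo; length; zip)
open import Data.Bool.ListAction using (all; any)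
open import Data.Product using (_,_)

-- Permutations of [n] represented as words (lists) w₁…wₙ over {0,…,n-1}
-- (0-based values; order isomorphism is unaffected by the shift).

words : ℕ → ℕ → List (List ℕ)
words n zero    = [] ∷ []
words n (suc k) = concatMap (λ a → map (a ∷_) (words n k)) (upTo n)

distinct : List ℕ → Bool
distinct []       = true
distinct (a ∷ as) = all (λ b → not (a ≡ᵇ b)) as ∧ distinct as

-- a word of length n over {0,…,n-1} with distinct entries is a
-- permutation of [n]; so S n enumerates S_n (S 0 = [ empty permutation ])
S : ℕ → List (List ℕ)
S n = go (words n n)
  where
  go : List (List ℕ) → List (List ℕ)
  go []       = []
  go (w ∷ ws) = if distinct w then w ∷ go ws else go ws

subseqs : List ℕ → List (List ℕ)
subseqs []       = [] ∷ []
subseqs (a ∷ as) = map (a ∷_) (subseqs as) Data.List.++ subseqs as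
  where import Data.List

-- order-isomorphism of two sequences of distinct entries:
-- same length and for every pair of positions i < j,
-- (s_i < s_j) iff (t_i < t_j)
orderIso : List ℕ → List ℕ → Bool
orderIso []       []       = true
orderIso (a ∷ as) (b ∷ bs) =
  all (λ { (a′ , b′) → eqB (a <ᵇ a′) (b <ᵇ b′) }) (zip as bs) ∧ orderIso as bs
  where
  eqB : Bool → Bool → Bool
  eqB true  y = y
  eqB false y = not y
orderIso _        _        = false

contains : List ℕ → List ℕ → Bool
contains σ τ = any (λ s → orderIso s τ) (subseqs σ)

avoidsAll : List (List ℕ) → List ℕ → Bool
avoidsAll T σ = all (λ τ → not (contains σ τ)) T

count : {A : Set} → (A → Bool) → List A → ℕ
count p []       = zero
count p (x ∷ xs) = if p x then suc (count p xs) else count p xs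

numAvoid : List (List ℕ) → ℕ → ℕ
numAvoid T n = count (avoidsAll T) (S n)

Series : Set
Series = ℕ → ℤ

infixl 6 _⊕_ _⊖_
infixl 7 _⊛_

_⊕_ : Series → Series → Series
(f ⊕ g) n = f n ℤ.+ g n

_⊖_ : Series → Series → Series
(f ⊖ g) n = f n - g n

const : ℤ → Series
const c zero    = c
const c (suc _) = + 0

X : Series
X 1 = + 1
X _ = + 0

_⊛_ : Series → Series → Series
(f ⊛ g) n = go n
  where
  go : ℕ → ℤ
  go zero    = f zero ℤ.* g n
  go (suc k) = go k ℤ.+ f (suc k) ℤ.* g (n ℕ.∸ suc k)

genFun : List (List ℕ) → Series
genFun T n = + numAvoid T n

T₃₃₅ : List (List ℕ)
T₃₃₅ = (2 ∷ 3 ∷ 4 ∷ 1 ∷ []) ∷ (2 ∷ 4 ∷ 1 ∷ 3 ∷ []) ∷ (3 ∷ 4 ∷ 1 ∷ 2 ∷ []) ∷ []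

{-# OPTIONS --safe #-}
module Submission where

-- Let a be the first letter of an avoider.  Either everything above a follows
-- everything below a, or the word is a M u l v where u is the decreasing run of the
-- values just above a, l is a nonempty decreasing run below a, and v lies above all
-- the rest.  Since the three patterns are sum indecomposable, F = 1 + I F, where I
-- counts the sum indecomposable avoiders a M (M an avoider below a) and a M u l.
-- For the latter one needs the series C of the pairs (M , l) such that M l avoids T,
-- l is nonempty and decreasing, and no rise x < y of M is followed by a letter of l
-- below x.  Then I = x F + B with B = C x²/(1-x), and splitting (M , l) at the first
-- letter of M gives C = x/(1-x) + x C + I C + B.  Eliminating I, B and C yields the
-- cubic.  All pieces are kept as permutations of intervals [lo, hi), so that no
-- standardization is ever needed.

open import Defs
open import Algebra.Bundles using (CommutativeRing)
open import Algebra.Solver.Ring.AlmostCommutativeRing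
  using (AlmostCommutativeRing; fromCommutativeRing; _-Raw-AlmostCommutative⟶_)
import Algebra.Solver.Ring as Solver
open import Data.Bool using (Bool; true; false; T; not)
open import Data.Bool.Properties using (T-∧; T?)
open import Data.Empty using (⊥-elim)
open import Data.Integer as ℤ using (ℤ; +_; -_)
import Data.Integer.Properties as ℤ
open import Data.Integer.Tactic.RingSolver using (solve-∀)
open import Data.List.Base using (List; []; _∷_; _++_; [_]; map; length; upTo; filter; filterᵇ;
  concatMap; deduplicate; cartesianProduct; cartesianProductWith; initLast; _∷ʳ′_)
open import Data.List.Properties using (≡-dec; length-map; length-++; length-++-sucʳ; length-upTo;
  ++-assoc; ++-cancelˡ; ++-identityʳ; ∷-injective; ∷-injectiveˡ; ∷ʳ-injectiveʳ; map-++; map-injective)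
open import Data.List.Membership.Propositional using (_∈_; find; lose)
open import Data.List.Membership.Propositional.Properties
import Data.List.Membership.DecPropositional as DecMembership
open import Data.List.Relation.Unary.All as All using (All; []; _∷_)
import Data.List.Relation.Unary.All.Properties as All
open import Data.List.Relation.Unary.AllPairs as AllPairs using (AllPairs; []; _∷_)
import Data.List.Relation.Unary.AllPairs.Properties as AllPairs
open import Data.List.Relation.Unary.Any using (Any; here; there)
import Data.List.Relation.Unary.Any.Properties as Any
open import Data.List.Relation.Unary.Unique.Propositional using (Unique)
import Data.List.Relation.Unary.Unique.Propositional.Properties as Unique
import Data.List.Relation.Unary.Unique.DecPropositional.Properties as UniqueDec
open import Data.List.Relation.Binary.Sublist.Propositional as Sub
  using (_⊆_; []; _∷_; _∷ʳ_; from∈; ⊆-refl; ⊆-trans; minimum)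
import Data.List.Relation.Binary.Sublist.Propositional.Properties as Subₚ
open import Data.List.Relation.Binary.Permutation.Propositional as ↭
  using (_↭_; ↭-sym; ↭-trans; ↭-reflexive)
import Data.List.Relation.Binary.Permutation.Propositional.Properties as ↭ₚ
open import Data.Maybe using (Maybe; just; nothing)
open import Data.Nat as ℕ using (ℕ; zero; suc; _∸_; _≤_; _<_; _>_; _<?_; _<ᵇ_; z≤n; s≤s)
import Data.Nat.Properties as ℕ
open import Data.Product using (∃; ∃₂; _×_; _,_; proj₁; proj₂)
open import Data.Product.Properties using (,-injective) renaming (≡-dec to ×-≡-dec)
open import Data.Sum using (_⊎_; inj₁; inj₂)
open import Data.Unit using (⊤; tt)
open import Function using (_∘_; case_of_)
open import Function.Bundles using (Equivalence)
open import Relation.Binary using (DecidableEquality)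
open import Relation.Binary.PropositionalEquality
  using (_≡_; _≢_; refl; sym; trans; cong; cong₂; subst; subst₂; module ≡-Reasoning)
open import Relation.Nullary using (¬_; Dec; yes; no; contradiction)
open import Relation.Nullary.Decidable using (map′; _×-dec_; _→-dec_; ¬?; dec-true; dec-false)
open import Relation.Unary using (Decidable)

open ≡-Reasoning

-- The letters of `M` and `l` interleave in value, so a word `a M u l` is not a product of
-- independent factors; this forces the pairs to be counted jointly. Once `u` stands between them, a
-- rise of `M`, a letter of `u` and a smaller letter of `l` form 2341, which is the origin of the
-- condition on rises. The equation for the pairs closes up because the decreasing word `l`,
-- compared with the first letter of `M`, is all below it, all above it, or cut into an upper prefix
-- and a lower suffix, and none of these leaves the classes already introduced. Every equation of
-- series comes from a unique decomposition. Uniqueness rests on one observation: an indecomposable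
-- avoider ends in a letter not above its first letter, so appending letters that all lie above it
-- never gives another one. No formula for the number of pairs is needed, only the existence of a
-- finite count, since the equations do the rest.

sumTo : (ℕ → ℤ) → ℕ → ℤ
sumTo h zero    = h 0
sumTo h (suc k) = sumTo h k ℤ.+ h (suc k)

-- The two statements are mutual so that the underscore is solved by the local,
-- otherwise unnameable, accumulator of _⊛_; abstracting _+_ lets the unifier see it.
mutual
  ⊛-sumTo-suc : ∀ f g n → (f ⊛ g) (suc n) ≡
    sumTo (λ i → f i ℤ.* g (suc n ∸ i)) n ℤ.+ f (suc n) ℤ.* g (suc n ∸ suc n)
  ⊛-sumTo-suc f g n with suc n | ℤ._+_
  ... | m | _+′_ = cong₂ _+′_ (⊛-partial f g m n) refl

  ⊛-partial : ∀ f g m k → _ ≡ sumTo (λ i → f i ℤ.* g (m ∸ i)) k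
  ⊛-partial f g m zero    = refl
  ⊛-partial f g m (suc k) = cong (ℤ._+ f (suc k) ℤ.* g (m ∸ suc k)) (⊛-partial f g m k)

sumTo-cong : ∀ {h k} n → (∀ i → i ℕ.≤ n → h i ≡ k i) → sumTo h n ≡ sumTo k n
sumTo-cong zero    eq = eq 0 ℕ.≤-refl
sumTo-cong (suc n) eq =
  cong₂ ℤ._+_ (sumTo-cong n (λ i i≤n → eq i (ℕ.m≤n⇒m≤1+n i≤n))) (eq (suc n) ℕ.≤-refl)

sumTo-head : ∀ h n → sumTo h (suc n) ≡ h 0 ℤ.+ sumTo (λ i → h (suc i)) n
sumTo-head h zero    = refl
sumTo-head h (suc n) =
  trans (cong (ℤ._+ h (suc (suc n))) (sumTo-head h n)) (ℤ.+-assoc (h 0) _ _)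

⊛-sumTo : ∀ f g n → (f ⊛ g) n ≡ sumTo (λ i → f i ℤ.* g (n ∸ i)) n
⊛-sumTo f g zero    = refl
⊛-sumTo f g (suc n) = ⊛-sumTo-suc f g n

-- The ring of formal power series over the integers

tail : Series → Series
tail f n = f (suc n)

-- Together with `⊛-unfoldʳ` this turns the Cauchy product into a recursion on the degree in which
-- one factor is replaced by its tail, so the ring laws follow by induction on the degree with the
-- series left general.
⊛-unfoldˡ : ∀ f g n → (f ⊛ g) (suc n) ≡ f 0 ℤ.* g (suc n) ℤ.+ (tail f ⊛ g) n
⊛-unfoldˡ f g n = trans (⊛-sumTo f g (suc n))
  (trans (sumTo-head (λ i → f i ℤ.* g (suc n ∸ i)) n)
         (cong (λ t → f 0 ℤ.* g (suc n) ℤ.+ t) (sym (⊛-sumTo (tail f) g n))))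

⊛-unfoldʳ : ∀ f g n → (f ⊛ g) (suc n) ≡ (f ⊛ tail g) n ℤ.+ f (suc n) ℤ.* g 0
⊛-unfoldʳ f g n = trans (⊛-sumTo f g (suc n)) (cong₂ ℤ._+_
  (trans (sumTo-cong n (λ i i≤n → cong (λ j → f i ℤ.* g j) (ℕ.+-∸-assoc 1 i≤n)))
         (sym (⊛-sumTo f (tail g) n)))
  (cong (λ j → f (suc n) ℤ.* g j) (ℕ.n∸n≡0 n)))

infix 4 _≈_

_≈_ : Series → Series → Set
f ≈ g = ∀ n → f n ≡ g n

⊛-cong : ∀ {f f′ g g′} → f ≈ f′ → g ≈ g′ → f ⊛ g ≈ f′ ⊛ g′
⊛-cong f≈ g≈ zero    = cong₂ ℤ._*_ (f≈ 0) (g≈ 0)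
⊛-cong {f} {f′} {g} {g′} f≈ g≈ (suc n) = begin
  (f ⊛ g) (suc n)                              ≡⟨ ⊛-unfoldˡ f g n ⟩
  f 0 ℤ.* g (suc n) ℤ.+ (tail f ⊛ g) n         ≡⟨ cong₂ ℤ._+_ (cong₂ ℤ._*_ (f≈ 0) (g≈ (suc n)))
                                                     (⊛-cong (λ k → f≈ (suc k)) g≈ n) ⟩
  f′ 0 ℤ.* g′ (suc n) ℤ.+ (tail f′ ⊛ g′) n     ≡⟨ ⊛-unfoldˡ f′ g′ n ⟨
  (f′ ⊛ g′) (suc n)                            ∎

⊛-comm : ∀ f g → f ⊛ g ≈ g ⊛ f
⊛-comm f g zero    = ℤ.*-comm (f 0) (g 0)
⊛-comm f g (suc n) = begin
  (f ⊛ g) (suc n)                         ≡⟨ ⊛-unfoldˡ f g n ⟩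
  f 0 ℤ.* g (suc n) ℤ.+ (tail f ⊛ g) n    ≡⟨ ℤ.+-comm (f 0 ℤ.* g (suc n)) _ ⟩
  (tail f ⊛ g) n ℤ.+ f 0 ℤ.* g (suc n)    ≡⟨ cong₂ ℤ._+_ (⊛-comm (tail f) g n) (ℤ.*-comm (f 0) _) ⟩
  (g ⊛ tail f) n ℤ.+ g (suc n) ℤ.* f 0    ≡⟨ ⊛-unfoldʳ g f n ⟨
  (g ⊛ f) (suc n)                         ∎

⊛-distribʳ : ∀ h f g → (f ⊕ g) ⊛ h ≈ f ⊛ h ⊕ g ⊛ h
⊛-distribʳ h f g zero    = ℤ.*-distribʳ-+ (h 0) (f 0) (g 0)
⊛-distribʳ h f g (suc n) = begin
  ((f ⊕ g) ⊛ h) (suc n)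
    ≡⟨ ⊛-unfoldˡ (f ⊕ g) h n ⟩
  (f 0 ℤ.+ g 0) ℤ.* h (suc n) ℤ.+ ((tail f ⊕ tail g) ⊛ h) n
    ≡⟨ cong (λ t → (f 0 ℤ.+ g 0) ℤ.* h (suc n) ℤ.+ t) (⊛-distribʳ h (tail f) (tail g) n) ⟩
  (f 0 ℤ.+ g 0) ℤ.* h (suc n) ℤ.+ ((tail f ⊛ h) n ℤ.+ (tail g ⊛ h) n)
    ≡⟨ rearrange (f 0) (g 0) (h (suc n)) _ _ ⟩
  (f 0 ℤ.* h (suc n) ℤ.+ (tail f ⊛ h) n) ℤ.+ (g 0 ℤ.* h (suc n) ℤ.+ (tail g ⊛ h) n)
    ≡⟨ cong₂ ℤ._+_ (⊛-unfoldˡ f h n) (⊛-unfoldˡ g h n) ⟨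
  (f ⊛ h ⊕ g ⊛ h) (suc n) ∎
  where
  rearrange : ∀ a b c x y →
    (a ℤ.+ b) ℤ.* c ℤ.+ (x ℤ.+ y) ≡ (a ℤ.* c ℤ.+ x) ℤ.+ (b ℤ.* c ℤ.+ y)
  rearrange = solve-∀

scale : ℤ → Series → Series
scale c f n = c ℤ.* f n

scale-⊛ : ∀ c f g → scale c f ⊛ g ≈ scale c (f ⊛ g)
scale-⊛ c f g zero    = ℤ.*-assoc c (f 0) (g 0)
scale-⊛ c f g (suc n) = begin
  (scale c f ⊛ g) (suc n)                                  ≡⟨ ⊛-unfoldˡ (scale c f) g n ⟩
  c ℤ.* f 0 ℤ.* g (suc n) ℤ.+ (scale c (tail f) ⊛ g) n     ≡⟨ cong₂ ℤ._+_ (ℤ.*-assoc c (f 0) _)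
                                                                 (scale-⊛ c (tail f) g n) ⟩
  c ℤ.* (f 0 ℤ.* g (suc n)) ℤ.+ c ℤ.* (tail f ⊛ g) n       ≡⟨ ℤ.*-distribˡ-+ c (f 0 ℤ.* g (suc n)) _ ⟨
  c ℤ.* (f 0 ℤ.* g (suc n) ℤ.+ (tail f ⊛ g) n)             ≡⟨ cong (c ℤ.*_) (⊛-unfoldˡ f g n) ⟨
  c ℤ.* (f ⊛ g) (suc n)                                    ∎

⊛-assoc : ∀ f g h → (f ⊛ g) ⊛ h ≈ f ⊛ (g ⊛ h)
⊛-assoc f g h zero    = ℤ.*-assoc (f 0) (g 0) (h 0)
⊛-assoc f g h (suc n) = begin
  ((f ⊛ g) ⊛ h) (suc n)
    ≡⟨ ⊛-unfoldˡ (f ⊛ g) h n ⟩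
  f 0 ℤ.* g 0 ℤ.* h (suc n) ℤ.+ (tail (f ⊛ g) ⊛ h) n
    ≡⟨ cong (λ t → f 0 ℤ.* g 0 ℤ.* h (suc n) ℤ.+ t) (⊛-cong {g = h} (⊛-unfoldˡ f g) (λ _ → refl) n) ⟩
  f 0 ℤ.* g 0 ℤ.* h (suc n) ℤ.+ ((scale (f 0) (tail g) ⊕ tail f ⊛ g) ⊛ h) n
    ≡⟨ cong (λ t → f 0 ℤ.* g 0 ℤ.* h (suc n) ℤ.+ t) (⊛-distribʳ h (scale (f 0) (tail g)) (tail f ⊛ g) n) ⟩
  f 0 ℤ.* g 0 ℤ.* h (suc n) ℤ.+ ((scale (f 0) (tail g) ⊛ h) n ℤ.+ ((tail f ⊛ g) ⊛ h) n)
    ≡⟨ cong (λ t → f 0 ℤ.* g 0 ℤ.* h (suc n) ℤ.+ t)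
         (cong₂ ℤ._+_ (scale-⊛ (f 0) (tail g) h n) (⊛-assoc (tail f) g h n)) ⟩
  f 0 ℤ.* g 0 ℤ.* h (suc n) ℤ.+ (f 0 ℤ.* (tail g ⊛ h) n ℤ.+ (tail f ⊛ (g ⊛ h)) n)
    ≡⟨ rearrange (f 0) (g 0) (h (suc n)) _ _ ⟩
  f 0 ℤ.* (g 0 ℤ.* h (suc n) ℤ.+ (tail g ⊛ h) n) ℤ.+ (tail f ⊛ (g ⊛ h)) n
    ≡⟨ cong (λ t → f 0 ℤ.* t ℤ.+ (tail f ⊛ (g ⊛ h)) n) (⊛-unfoldˡ g h n) ⟨
  f 0 ℤ.* (g ⊛ h) (suc n) ℤ.+ (tail f ⊛ (g ⊛ h)) n
    ≡⟨ ⊛-unfoldˡ f (g ⊛ h) n ⟨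
  (f ⊛ (g ⊛ h)) (suc n) ∎
  where
  rearrange : ∀ a b c x y →
    a ℤ.* b ℤ.* c ℤ.+ (a ℤ.* x ℤ.+ y) ≡ a ℤ.* (b ℤ.* c ℤ.+ x) ℤ.+ y
  rearrange = solve-∀

const-⊛ : ∀ c f → const c ⊛ f ≈ scale c f
const-⊛ c f zero    = refl
const-⊛ c f (suc n) = begin
  (const c ⊛ f) (suc n)                               ≡⟨ ⊛-unfoldˡ (const c) f n ⟩
  c ℤ.* f (suc n) ℤ.+ (tail (const c) ⊛ f) n          ≡⟨ cong (λ t → c ℤ.* f (suc n) ℤ.+ t) (0-⊛ n) ⟩
  c ℤ.* f (suc n) ℤ.+ + 0                             ≡⟨ ℤ.+-identityʳ _ ⟩
  c ℤ.* f (suc n)                                     ∎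
  where
  0-⊛ : ∀ n → (tail (const c) ⊛ f) n ≡ + 0
  0-⊛ n = trans (scale-⊛ (+ 0) (tail (const c)) f n) refl

X-⊛-suc : ∀ f n → (X ⊛ f) (suc n) ≡ f n
X-⊛-suc f n = begin
  (X ⊛ f) (suc n)                            ≡⟨ ⊛-unfoldˡ X f n ⟩
  + 0 ℤ.* f (suc n) ℤ.+ (tail X ⊛ f) n       ≡⟨ ℤ.+-identityˡ _ ⟩
  (tail X ⊛ f) n                             ≡⟨ ⊛-cong {g = f} tail-X (λ _ → refl) n ⟩
  (const (+ 1) ⊛ f) n                        ≡⟨ const-⊛ (+ 1) f n ⟩
  + 1 ℤ.* f n                                ≡⟨ ℤ.*-identityˡ (f n) ⟩
  f n                                        ∎
  where
  tail-X : tail X ≈ const (+ 1)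
  tail-X zero    = refl
  tail-X (suc n) = refl

const-+ : ∀ a b → const (a ℤ.+ b) ≈ const a ⊕ const b
const-+ a b zero    = refl
const-+ a b (suc n) = refl

const-* : ∀ a b → const (a ℤ.* b) ≈ const a ⊛ const b
const-* a b zero    = refl
const-* a b (suc n) = sym (trans (const-⊛ a (const b) (suc n)) (ℤ.*-zeroʳ a))

const-neg : ∀ a n → const (- a) n ≡ - const a n
const-neg a zero    = refl
const-neg a (suc n) = refl

const-0 : const (+ 0) ≈ λ _ → + 0
const-0 zero    = refl
const-0 (suc n) = refl

⊛-identityˡ : ∀ f → const (+ 1) ⊛ f ≈ f
⊛-identityˡ f n = trans (const-⊛ (+ 1) f n) (ℤ.*-identityˡ (f n))

seriesRing : CommutativeRing _ _
seriesRing = record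
  { Carrier = Series ; _≈_ = _≈_ ; _+_ = _⊕_ ; _*_ = _⊛_
  ; -_ = λ f n → - f n ; 0# = λ _ → + 0 ; 1# = const (+ 1)
  ; isCommutativeRing = record
    { isRing = record
      { +-isAbelianGroup = record
        { isGroup = record
          { isMonoid = record
            { isSemigroup = record
              { isMagma = record
                { isEquivalence = record
                  { refl  = λ _ → refl
                  ; sym   = λ p n → sym (p n)
                  ; trans = λ p q n → trans (p n) (q n) }
                ; ∙-cong = λ p q n → cong₂ ℤ._+_ (p n) (q n) }
              ; assoc = λ f g h n → ℤ.+-assoc (f n) (g n) (h n) }
            ; identity = (λ f n → ℤ.+-identityˡ (f n)) , (λ f n → ℤ.+-identityʳ (f n)) }
          ; inverse = (λ f n → ℤ.+-inverseˡ (f n)) , (λ f n → ℤ.+-inverseʳ (f n))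
          ; ⁻¹-cong = λ p n → cong -_ (p n) }
        ; comm = λ f g n → ℤ.+-comm (f n) (g n) }
      ; *-cong     = ⊛-cong
      ; *-assoc    = ⊛-assoc
      ; *-identity = ⊛-identityˡ
                   , λ f n → trans (⊛-comm f (const (+ 1)) n) (⊛-identityˡ f n)
      ; distrib    = (λ h f g n → trans (⊛-comm h (f ⊕ g) n)
                       (trans (⊛-distribʳ h f g n)
                              (cong₂ ℤ._+_ (⊛-comm f h n) (⊛-comm g h n))))
                   , ⊛-distribʳ }
    ; *-comm = ⊛-comm } }

seriesACR : AlmostCommutativeRing _ _
seriesACR = fromCommutativeRing seriesRing

-- Coefficients are taken in the integers because the solver has to recognise vanishing
-- coefficients, and equality of whole series is undecidable.
constHom : CommutativeRing.rawRing ℤ.+-*-commutativeRing -Raw-AlmostCommutative⟶ seriesACR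
constHom = record
  { ⟦_⟧ = const ; +-homo = const-+ ; *-homo = const-* ; -‿homo = const-neg
  ; 0-homo = const-0 ; 1-homo = λ _ → refl }

const≟ : ∀ a b → Maybe (const a ≈ const b)
const≟ a b with a ℤ.≟ b
... | yes refl = just (λ _ → refl)
... | no _     = nothing

module SeriesSolver = Solver (CommutativeRing.rawRing ℤ.+-*-commutativeRing) seriesACR constHom const≟

-- Elimination of the auxiliary series

absorb : ∀ e q f g → f ≈ g → e ⊕ q ⊛ (f ⊖ g) ≈ e
absorb e q f g f≈g n = begin
  e n ℤ.+ (q ⊛ (f ⊖ g)) n        ≡⟨ cong (λ t → e n ℤ.+ t) (⊛-cong {q} (λ _ → refl) f⊖g≈0 n) ⟩
  e n ℤ.+ (q ⊛ const (+ 0)) n    ≡⟨ cong (λ t → e n ℤ.+ t) (⊛-comm q (const (+ 0)) n) ⟩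
  e n ℤ.+ (const (+ 0) ⊛ q) n    ≡⟨ cong (λ t → e n ℤ.+ t) (const-⊛ (+ 0) q n) ⟩
  e n ℤ.+ + 0                    ≡⟨ ℤ.+-identityʳ (e n) ⟩
  e n                            ∎
  where
  f⊖g≈0 : f ⊖ g ≈ const (+ 0)
  f⊖g≈0 k = trans (ℤ.i≡j⇒i-j≡0 (f≈g k)) (sym (const-0 k))

one : Series
one = const (+ 1)

-- Nothing is inverted: each equation enters as a difference times a cofactor, and `absorb` discards
-- it. Multiply the equation for `C` by `(1 - X)² V F`. With `F (1 - I) = 1`, `(1 - X) U = X` and
-- `V = X U` it becomes `p B = X³ F`, where `p` expands to `(1 - X)(1 - X - X F)`. Since
-- `F B = F - 1 - X F²`, the cubic is the expansion of `(1 - X)(1 - X - X F)(F - 1 - X F²) = X³ F²`.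
eliminate : ∀ F I B C U V →
  F ≈ one ⊕ I ⊛ F →
  I ≈ X ⊛ F ⊕ B →
  B ≈ C ⊛ V →
  C ≈ U ⊕ X ⊛ C ⊕ I ⊛ C ⊕ B →
  V ≈ X ⊛ U →
  U ≈ X ⊕ X ⊛ U →
  F ≈ (one ⊖ X) ⊛ (one ⊖ X)
      ⊕ X ⊛ F
      ⊕ X ⊛ (const (+ 2) ⊖ const (+ 3) ⊛ X ⊕ const (+ 2) ⊛ X ⊛ X) ⊛ F ⊛ F
      ⊖ X ⊛ X ⊛ (one ⊖ X) ⊛ F ⊛ F ⊛ F
eliminate F I B C U V h₁ h₂ h₃ h₄ h₅ h₆ n =
  trans (certificate n)
  (trans (absorb e₅ q₆ U (X ⊕ X ⊛ U) h₆ n)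
  (trans (absorb e₄ q₅ V (X ⊛ U) h₅ n)
  (trans (absorb e₃ q₄ C (U ⊕ X ⊛ C ⊕ I ⊛ C ⊕ B) h₄ n)
  (trans (absorb e₂ q₃ B (C ⊛ V) h₃ n)
  (trans (absorb e₁ q₂ I (X ⊛ F ⊕ B) h₂ n)
         (absorb e₀ q₁ F (one ⊕ I ⊛ F) h₁ n))))))
  where
  -- F minus the claimed right-hand side is a combination of the six equations; the
  -- cofactors come from eliminating I, then U, V and C from the equation for F B.
  p r q₁ q₂ q₃ q₄ q₅ q₆ e₀ e₁ e₂ e₃ e₄ e₅ : Series
  p  = (one ⊖ X) ⊛ (one ⊖ X) ⊛ (one ⊖ X ⊛ F) ⊖ X ⊛ X ⊛ (one ⊖ X) ⊛ F
  r  = (one ⊖ X) ⊛ F ⊛ F ⊛ (one ⊖ I ⊖ X)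
  q₁ = p ⊖ (one ⊖ X) ⊛ (one ⊖ X) ⊛ B ⊛ F
  q₂ = p ⊛ F
  q₃ = r ⊛ (one ⊖ X)
  q₄ = (one ⊖ X) ⊛ F ⊛ F ⊛ X ⊛ X
  q₅ = r ⊛ (one ⊖ X) ⊛ C
  q₆ = r ⊛ X ⊛ C ⊕ F ⊛ F ⊛ X ⊛ X
  e₀ = (one ⊖ X) ⊛ (one ⊖ X)
       ⊕ X ⊛ F
       ⊕ X ⊛ (const (+ 2) ⊖ const (+ 3) ⊛ X ⊕ const (+ 2) ⊛ X ⊛ X) ⊛ F ⊛ F
       ⊖ X ⊛ X ⊛ (one ⊖ X) ⊛ F ⊛ F ⊛ F
  e₁ = e₀ ⊕ q₁ ⊛ (F ⊖ (one ⊕ I ⊛ F))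
  e₂ = e₁ ⊕ q₂ ⊛ (I ⊖ (X ⊛ F ⊕ B))
  e₃ = e₂ ⊕ q₃ ⊛ (B ⊖ C ⊛ V)
  e₄ = e₃ ⊕ q₄ ⊛ (C ⊖ (U ⊕ X ⊛ C ⊕ I ⊛ C ⊕ B))
  e₅ = e₄ ⊕ q₅ ⊛ (V ⊖ X ⊛ U)

  certificate : F ≈ e₅ ⊕ q₆ ⊛ (U ⊖ (X ⊕ X ⊛ U))
  certificate = SeriesSolver.solve 7 (λ x F I B C U V →
    let open SeriesSolver using (con; _:+_; _:*_; _:-_; _:=_)
        𝟙 = con (+ 1)
        p = (𝟙 :- x) :* (𝟙 :- x) :* (𝟙 :- x :* F) :- x :* x :* (𝟙 :- x) :* F
        r = (𝟙 :- x) :* F :* F :* (𝟙 :- I :- x)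
    in F := (𝟙 :- x) :* (𝟙 :- x)
      :+ x :* F
      :+ x :* (con (+ 2) :- con (+ 3) :* x :+ con (+ 2) :* x :* x) :* F :* F
      :- x :* x :* (𝟙 :- x) :* F :* F :* F
      :+ (p :- (𝟙 :- x) :* (𝟙 :- x) :* B :* F) :* (F :- (𝟙 :+ I :* F))
      :+ p :* F :* (I :- (x :* F :+ B))
      :+ r :* (𝟙 :- x) :* (B :- C :* V)
      :+ (𝟙 :- x) :* F :* F :* x :* x :* (C :- (U :+ x :* C :+ I :* C :+ B))
      :+ r :* (𝟙 :- x) :* C :* (V :- x :* U)
      :+ (r :* x :* C :+ F :* F :* x :* x) :* (U :- (x :+ x :* U)))
    (λ _ → refl) X F I B C U V

-- Counting

private variable
  A B : Set
  m n : ℕ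

Unique-length-≤ : {xs ys : List A} → Unique xs → (∀ {x} → x ∈ xs → x ∈ ys) → length xs ≤ length ys
Unique-length-≤ {xs = []}     _          _  = z≤n
Unique-length-≤ {xs = x ∷ xs} (x∉ ∷ uxs) sub with ∈-∃++ (sub (here refl))
... | ps , qs , refl = subst (suc (length xs) ≤_) (sym (length-++-sucʳ ps x qs))
  (s≤s (Unique-length-≤ uxs λ {y} y∈ → rest y∈ (∈-++⁻ ps (sub (there y∈)))))
  where
  rest : ∀ {y} → y ∈ xs → y ∈ ps ⊎ y ∈ x ∷ qs → y ∈ ps ++ qs
  rest _  (inj₁ y∈)           = ∈-++⁺ˡ y∈
  rest y∈ (inj₂ (here refl))  = contradiction refl (All.lookup x∉ y∈)
  rest _  (inj₂ (there y∈))   = ∈-++⁺ʳ ps y∈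

-- Elements are counted, not proofs of `P`, so `P` may be an existential statement with several
-- proofs for one element.
record Count (P : A → Set) (n : ℕ) : Set where
  field
    elems    : List A
    nodup    : Unique elems
    sound    : ∀ {x} → x ∈ elems → P x
    complete : ∀ {x} → P x → x ∈ elems
    size     : length elems ≡ n
open Count

Count-nodup : {P : A → Set} → Count P m → Count P n → m ≡ n
Count-nodup c d = subst₂ _≡_ (size c) (size d) (ℕ.≤-antisym
  (Unique-length-≤ (nodup c) (complete d ∘ sound c))
  (Unique-length-≤ (nodup d) (complete c ∘ sound d)))

Unique-map : (f : A → B) {xs : List A} →
  (∀ {x y} → x ∈ xs → y ∈ xs → f x ≡ f y → x ≡ y) → Unique xs → Unique (map f xs)
Unique-map f         inj []         = []
Unique-map f {x ∷ xs} inj (x∉ ∷ uxs) =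
  All.map⁺ (All.tabulate λ y∈ fx≡fy → All.lookup x∉ y∈ (inj (here refl) (there y∈) fx≡fy))
  ∷ Unique-map f (λ p q → inj (there p) (there q)) uxs

Count-map : {P : A → Set} {Q : B → Set} (f : A → B) →
  (∀ {x y} → P x → P y → f x ≡ f y → x ≡ y) →
  (∀ {x} → P x → Q (f x)) →
  (∀ {y} → Q y → ∃ λ x → P x × y ≡ f x) →
  Count P n → Count Q n
Count-map {Q = Q} f inj to from c = record
  { elems    = map f (elems c)
  ; nodup    = Unique-map f (λ p q → inj (sound c p) (sound c q)) (nodup c)
  ; sound    = λ y∈ → let x , x∈ , y≡ = ∈-map⁻ f y∈ in subst Q (sym y≡) (to (sound c x∈))
  ; complete = λ q → let x , p , y≡ = from q in
                     subst (_∈ map f (elems c)) (sym y≡) (∈-map⁺ f (complete c p))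
  ; size     = trans (length-map f (elems c)) (size c) }

Count-⇔ : {P Q : A → Set} → (∀ {x} → P x → Q x) → (∀ {x} → Q x → P x) → Count P n → Count Q n
Count-⇔ to from = Count-map (λ x → x) (λ _ _ eq → eq) to (λ q → _ , from q , refl)

Count-∅ : {P : A → Set} → (∀ {x} → ¬ P x) → Count P 0
Count-∅ ¬p = record
  { elems = [] ; nodup = [] ; sound = λ () ; complete = λ p → contradiction p ¬p ; size = refl }

Count-singleton : {P : A → Set} (x : A) → P x → (∀ {y} → P y → y ≡ x) → Count P 1
Count-singleton x px only = record
  { elems = x ∷ [] ; nodup = [] ∷ []
  ; sound = λ { (here refl) → px } ; complete = λ p → here (only p) ; size = refl }

Count-⊎ : {P Q : A → Set} → (∀ {x} → P x → ¬ Q x) →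
  Count P m → Count Q n → Count (λ x → P x ⊎ Q x) (m ℕ.+ n)
Count-⊎ {P = P} {Q} disj c d = record
  { elems    = elems c ++ elems d
  ; nodup    = Unique.++⁺ (nodup c) (nodup d) (λ (p , q) → disj (sound c p) (sound d q))
  ; sound    = λ x∈ → side (∈-++⁻ (elems c) x∈)
  ; complete = λ { (inj₁ p) → ∈-++⁺ˡ (complete c p)
                 ; (inj₂ q) → ∈-++⁺ʳ (elems c) (complete d q) }
  ; size     = trans (length-++ (elems c)) (cong₂ ℕ._+_ (size c) (size d)) }
  where
  side : ∀ {x} → x ∈ elems c ⊎ x ∈ elems d → P x ⊎ Q x
  side (inj₁ p) = inj₁ (sound c p)
  side (inj₂ q) = inj₂ (sound d q)

length-cartesianProduct : (xs : List A) (ys : List B) →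
  length (cartesianProduct xs ys) ≡ length xs ℕ.* length ys
length-cartesianProduct []       ys = refl
length-cartesianProduct (x ∷ xs) ys = trans (length-++ (map (x ,_) ys))
  (cong₂ ℕ._+_ (length-map (x ,_) ys) (length-cartesianProduct xs ys))

Count-× : {P : A → Set} {Q : B → Set} →
  Count P m → Count Q n → Count (λ (x , y) → P x × Q y) (m ℕ.* n)
Count-× c d = record
  { elems    = cartesianProduct (elems c) (elems d)
  ; nodup    = Unique.cartesianProduct⁺ (nodup c) (nodup d)
  ; sound    = λ xy∈ → let p , q = ∈-cartesianProduct⁻ (elems c) (elems d) xy∈ in
                       sound c p , sound d q
  ; complete = λ (p , q) → ∈-cartesianProduct⁺ (complete c p) (complete d q)
  ; size     = trans (length-cartesianProduct (elems c) (elems d)) (cong₂ ℕ._*_ (size c) (size d)) }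

Count-exists : {P : A → Set} → DecidableEquality A → (∀ x → Dec (P x)) →
  (xs : List A) → (∀ {x} → P x → x ∈ xs) → ∃ (Count P)
Count-exists _≟_ P? xs cover = _ , record
  { elems    = deduplicate _≟_ (filter P? xs)
  ; nodup    = UniqueDec.deduplicate-! _≟_ (filter P? xs)
  ; sound    = λ x∈ → proj₂ (∈-filter⁻ P? {xs = xs} (∈-deduplicate⁻ _≟_ (filter P? xs) x∈))
  ; complete = λ p → ∈-deduplicate⁺ _≟_ (∈-filter⁺ P? (cover p) p)
  ; size     = refl }

-- P lo hi x says that x is a structure of kind P on the interval [lo, hi).
Structure : Set → Set₁
Structure A = ℕ → ℕ → A → Set

-- The count may depend on the length of the interval only. All left ends are needed because the
-- second factor of a product lives on an interval that starts at the cut.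
Counts : Structure A → Series → Set
Counts P f = ∀ lo n → ∃ λ k → f n ≡ + k × Count (P lo (lo ℕ.+ n)) k

Counts-≈ : (P : Structure A) {f g : Series} → Counts P f → Counts P g → f ≈ g
Counts-≈ P c d n with c 0 n | d 0 n
... | k , fn≡k , ck | l , gn≡l , cl = trans fn≡k (trans (cong +_ (Count-nodup ck cl)) (sym gn≡l))

Counts-⇔ : (P Q : Structure A) {f : Series} →
  (∀ lo hi {x} → P lo hi x → Q lo hi x) → (∀ lo hi {x} → Q lo hi x → P lo hi x) →
  Counts P f → Counts Q f
Counts-⇔ P Q to from c lo n with c lo n
... | k , eq , ck = k , eq , Count-⇔ (to lo (lo ℕ.+ n)) (from lo (lo ℕ.+ n)) ck

Image : (A → B) → Structure A → Structure B
Image g P lo hi y = ∃ λ x → P lo hi x × y ≡ g x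

Counts-Image : (g : A → B) (P : Structure A) {f : Series} →
  (∀ lo hi {x y} → P lo hi x → P lo hi y → g x ≡ g y → x ≡ y) →
  Counts P f → Counts (Image g P) f
Counts-Image g P inj c lo n with c lo n
... | k , eq , ck = k , eq , Count-map g (inj lo (lo ℕ.+ n)) (λ p → _ , p , refl) (λ q → q) ck

infixl 5 _∪_
infixl 6 _⊗_

_∪_ : Structure A → Structure A → Structure A
(P ∪ Q) lo hi x = P lo hi x ⊎ Q lo hi x

Counts-∪ : (P Q : Structure A) {f g : Series} → (∀ lo hi {x} → P lo hi x → ¬ Q lo hi x) →
  Counts P f → Counts Q g → Counts (P ∪ Q) (f ⊕ g)
Counts-∪ P Q disj c d lo n with c lo n | d lo n
... | k , f≡ , ck | l , g≡ , cl =
  k ℕ.+ l , cong₂ ℤ._+_ f≡ g≡ , Count-⊎ (disj lo (lo ℕ.+ n)) ck cl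

-- The cut `c` belongs to the element. Products with different cuts are thus disjoint, which gives
-- the Cauchy product, and in return injectivity of a map out of a product includes recovering the
-- cut.
_⊗_ : Structure A → Structure B → Structure (ℕ × A × B)
(P ⊗ Q) lo hi (c , x , y) = lo ≤ c × c ≤ hi × P lo c x × Q c hi y

Counts-⊗ : (P : Structure A) (Q : Structure B) {f g : Series} →
  Counts P f → Counts Q g → Counts (P ⊗ Q) (f ⊛ g)
Counts-⊗ {A = A} {B} P Q {f} {g} cP cQ lo n =
  let k , eq , c = below n ℕ.≤-refl in k , trans (⊛-sumTo f g n) eq , c
  where
  hi = lo ℕ.+ n

  -- `At i` is the single term of the Cauchy product with the cut at offset `i`; `Below j` is its
  -- partial sum up to offset `j`.
  At Below : ℕ → ℕ × A × B → Set
  At    i (c , x , y) = c ≡ lo ℕ.+ i × P lo c x × Q c hi y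
  Below j (c , x , y) = lo ≤ c × c ≤ lo ℕ.+ j × P lo c x × Q c hi y

  at : ∀ i → i ≤ n → ∃ λ k → f i ℤ.* g (n ∸ i) ≡ + k × Count (At i) k
  at i i≤n with cP lo i | cQ (lo ℕ.+ i) (n ∸ i)
  ... | k , f≡ , ck | l , g≡ , cl =
    k ℕ.* l , trans (cong₂ ℤ._*_ f≡ g≡) (sym (ℤ.pos-* k l)) ,
    Count-map {P = λ (x , y) → P lo (lo ℕ.+ i) x × Q (lo ℕ.+ i) (lo ℕ.+ i ℕ.+ (n ∸ i)) y} {Q = At i}
      (λ (x , y) → lo ℕ.+ i , x , y) (λ { _ _ refl → refl })
      (λ {(x , y)} (p , q) → refl , p , subst (λ h → Q (lo ℕ.+ i) h y) eq q)
      (λ { {(_ , x , y)} (refl , p , q) →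
           (x , y) , (p , subst (λ h → Q (lo ℕ.+ i) h y) (sym eq) q) , refl })
      (Count-× ck cl)
    where
    eq : lo ℕ.+ i ℕ.+ (n ∸ i) ≡ hi
    eq = trans (ℕ.+-assoc lo i (n ∸ i)) (cong (lo ℕ.+_) (ℕ.m+[n∸m]≡n i≤n))

  below : ∀ j → j ≤ n → ∃ λ k → sumTo (λ i → f i ℤ.* g (n ∸ i)) j ≡ + k × Count (Below j) k
  below zero j≤n with at 0 j≤n
  ... | k , eq , c = k , eq , Count-⇔ {P = At 0} {Q = Below 0}
    (λ { (refl , p , q) → ℕ.m≤m+n lo 0 , ℕ.≤-refl , p , q })
    (λ (lo≤ , ≤lo , p , q) → ℕ.≤-antisym ≤lo (subst (_≤ _) (sym (ℕ.+-identityʳ lo)) lo≤) , p , q) c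
  below (suc j) j<n with below j (ℕ.<⇒≤ j<n) | at (suc j) j<n
  ... | k , eq , c | l , eq′ , d = k ℕ.+ l , cong₂ ℤ._+_ eq eq′ ,
    Count-⇔ {P = λ z → Below j z ⊎ At (suc j) z} {Q = Below (suc j)}
    (λ { (inj₁ (lo≤ , ≤j , p , q)) → lo≤ , ℕ.≤-trans ≤j (ℕ.+-monoʳ-≤ lo (ℕ.n≤1+n j)) , p , q
       ; (inj₂ (refl , p , q)) → ℕ.m≤m+n lo (suc j) , ℕ.≤-refl , p , q })
    (λ { {c , _} (lo≤ , ≤j , p , q) → case ℕ.m≤n⇒m<n∨m≡n ≤j of λ
         { (inj₁ c<) → inj₁ (lo≤ , ℕ.s≤s⁻¹ (subst (c <_) (ℕ.+-suc lo j) c<) , p , q)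
         ; (inj₂ c≡) → inj₂ (c≡ , p , q) } })
    (Count-⊎ {P = Below j} {Q = At (suc j)}
      (λ { (_ , ≤j , _) (refl , _) → ℕ.1+n≰n (ℕ.+-cancelˡ-≤ lo _ _ ≤j) }) c d)

-- As a factor it reserves one value. In `F ⊗ Single` the cut is the new maximum itself; in `C ⊗ V`
-- the cut is the first letter `a` of the block, and `U` starts at `suc a`.
Single : Structure ⊤
Single lo hi _ = hi ≡ suc lo

Counts-Single : Counts Single X
Counts-Single lo 0             = 0 , refl , Count-∅ (λ eq → ℕ.1+n≢n (sym (trans (sym (ℕ.+-identityʳ lo)) eq)))
Counts-Single lo 1             = 1 , refl , Count-singleton tt (ℕ.+-comm lo 1) (λ _ → refl)
Counts-Single lo (suc (suc n)) = 0 , refl ,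
  Count-∅ (λ eq → ℕ.m+1+n≢m lo (ℕ.suc-injective (trans (sym (ℕ.+-suc lo (suc n))) eq)))

-- Interval permutations and pattern avoidance

AllPairs-resp-⊆ : {xs ys : List A} {R : A → A → Set} → xs ⊆ ys → AllPairs R ys → AllPairs R xs
AllPairs-resp-⊆ []         []       = []
AllPairs-resp-⊆ (_ ∷ʳ s)   (_ ∷ ps) = AllPairs-resp-⊆ s ps
AllPairs-resp-⊆ (refl ∷ s) (p ∷ ps) = Subₚ.All-resp-⊆ s p ∷ AllPairs-resp-⊆ s ps

AllPairs-lookup : {xs : List A} {R : A → A → Set} {x y : A} → AllPairs R xs → (x ∷ y ∷ []) ⊆ xs → R x y
AllPairs-lookup ps s with AllPairs-resp-⊆ s ps
... | (r ∷ []) ∷ _ = r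

AllPairs-tabulate : {xs : List A} {R : A → A → Set} → (∀ {x y} → (x ∷ y ∷ []) ⊆ xs → R x y) → AllPairs R xs
AllPairs-tabulate {xs = []}     r = []
AllPairs-tabulate {xs = x ∷ xs} r =
  All.tabulate (λ y∈ → r (refl ∷ from∈ y∈)) ∷ AllPairs-tabulate (λ s → r (x ∷ʳ s))

++-split-⊆ : (xs : List A) {ys zs : List A} → zs ⊆ xs ++ ys → ∃₂ λ us vs → zs ≡ us ++ vs × us ⊆ xs × vs ⊆ ys
++-split-⊆ []       s = [] , _ , refl , [] , s
++-split-⊆ (x ∷ xs) (_ ∷ʳ s) with ++-split-⊆ xs s
... | us , vs , eq , s₁ , s₂ = us , vs , eq , x ∷ʳ s₁ , s₂
++-split-⊆ (x ∷ xs) (refl ∷ s) with ++-split-⊆ xs s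
... | us , vs , refl , s₁ , s₂ = x ∷ us , vs , refl , refl ∷ s₁ , s₂

Unique-resp-↭ : {xs ys : List A} → xs ↭ ys → Unique xs → Unique ys
Unique-resp-↭ ↭.refl         u                     = u
Unique-resp-↭ (↭.prep x p)   (x∉ ∷ u)              = ↭ₚ.All-resp-↭ p x∉ ∷ Unique-resp-↭ p u
Unique-resp-↭ (↭.swap x y p) ((x≢y ∷ x∉) ∷ y∉ ∷ u) =
  ((x≢y ∘ sym) ∷ ↭ₚ.All-resp-↭ p y∉) ∷ ↭ₚ.All-resp-↭ p x∉ ∷ Unique-resp-↭ p u
Unique-resp-↭ (↭.trans p q)  u                     = Unique-resp-↭ q (Unique-resp-↭ p u)

private variable
  a lo mid mid′ hi : ℕ
  w M l u v p p′ q xs ys : List ℕ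
  z : List ℕ × List ℕ

-- The field `lo≤hi` confines the empty word to empty intervals; the other fields alone would allow
-- it on any reversed one.
record Perm (lo hi : ℕ) (w : List ℕ) : Set where
  constructor mkPerm
  field
    lo≤hi  : lo ≤ hi
    unique : Unique w
    bounds : ∀ {x} → x ∈ w → lo ≤ x × x < hi
    full   : ∀ {x} → lo ≤ x → x < hi → x ∈ w
open Perm

Perm-[] : Perm lo lo []
Perm-[] = mkPerm ℕ.≤-refl [] (λ ()) (λ lo≤x x<lo → contradiction x<lo (ℕ.≤⇒≯ lo≤x))

Perm-singleton : Perm a (suc a) [ a ]
Perm-singleton {a} = mkPerm (ℕ.n≤1+n a) ([] ∷ []) (λ { (here refl) → ℕ.≤-refl , ℕ.n<1+n a })
  (λ a≤x x≤a → here (ℕ.≤-antisym (ℕ.s≤s⁻¹ x≤a) a≤x))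

Perm-resp-↭ : xs ↭ ys → Perm lo hi xs → Perm lo hi ys
Perm-resp-↭ p (mkPerm lo≤hi u b f) = mkPerm lo≤hi (Unique-resp-↭ p u)
  (λ x∈ → b (↭ₚ.∈-resp-↭ (↭-sym p) x∈)) (λ lo≤x x<hi → ↭ₚ.∈-resp-↭ p (f lo≤x x<hi))

Perm-++ : Perm lo mid xs → Perm mid hi ys → Perm lo hi (xs ++ ys)
Perm-++ {mid = mid} {xs = xs} p q = mkPerm (ℕ.≤-trans (lo≤hi p) (lo≤hi q))
  (Unique.++⁺ (unique p) (unique q)
    λ (x∈xs , x∈ys) → ℕ.<⇒≱ (proj₂ (bounds p x∈xs)) (proj₁ (bounds q x∈ys)))
  (λ x∈ → case ∈-++⁻ xs x∈ of λ
    { (inj₁ x∈xs) → proj₁ (bounds p x∈xs) , ℕ.<-≤-trans (proj₂ (bounds p x∈xs)) (lo≤hi q)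
    ; (inj₂ x∈ys) → ℕ.≤-trans (lo≤hi p) (proj₁ (bounds q x∈ys)) , proj₂ (bounds q x∈ys) })
  (λ {x} lo≤x x<hi → case x <? mid of λ
    { (yes x<m) → ∈-++⁺ˡ (full p lo≤x x<m)
    ; (no  x≮m) → ∈-++⁺ʳ xs (full q (ℕ.≮⇒≥ x≮m) x<hi) })

Perm-split : lo ≤ mid → mid ≤ hi → (∀ {x} → x ∈ xs → x < mid) → (∀ {x} → x ∈ ys → mid ≤ x) →
  Perm lo hi (xs ++ ys) → Perm lo mid xs × Perm mid hi ys
Perm-split {xs = xs} {ys} lo≤m m≤hi xs< ≤ys p =
  mkPerm lo≤m (AllPairs-resp-⊆ (Subₚ.++⁺ʳ ys ⊆-refl) (unique p))
    (λ x∈ → proj₁ (bounds p (∈-++⁺ˡ x∈)) , xs< x∈)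
    (λ lo≤x x<m → case ∈-++⁻ xs (full p lo≤x (ℕ.<-≤-trans x<m m≤hi)) of λ
      { (inj₁ x∈) → x∈ ; (inj₂ x∈) → contradiction (≤ys x∈) (ℕ.<⇒≱ x<m) }) ,
  mkPerm m≤hi (AllPairs-resp-⊆ (Subₚ.++⁺ˡ xs ⊆-refl) (unique p))
    (λ x∈ → ≤ys x∈ , proj₂ (bounds p (∈-++⁺ʳ xs x∈)))
    (λ m≤x x<hi → case ∈-++⁻ xs (full p (ℕ.≤-trans lo≤m m≤x) x<hi) of λ
      { (inj₁ x∈) → contradiction (xs< x∈) (ℕ.≤⇒≯ m≤x) ; (inj₂ x∈) → x∈ })

-- Used to read the cut of a product off the word on its lower part.
Perm-hi-unique : a ∈ w → Perm lo hi w → Perm lo mid w → hi ≡ mid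
Perm-hi-unique a∈ p q = ℕ.≤-antisym (hi≤ a∈ p q) (hi≤ a∈ q p)
  where
  hi≤ : a ∈ w → Perm lo hi w → Perm lo mid w → hi ≤ mid
  hi≤ {lo = lo} {hi} {mid} a∈ p q with mid <? hi
  ... | no  m≮hi = ℕ.≮⇒≥ m≮hi
  ... | yes m<hi = contradiction (proj₂ (bounds q (full p (lo≤hi q) m<hi))) ℕ.1+n≰n

-- The descents are not strict because orderIso only asks that the strict rises agree;
-- on words with distinct letters this makes no difference.
data Bad (a b c d : ℕ) : Set where
  bad-2341 : d ≤ a → a < b → b < c → Bad a b c d
  bad-2413 : c ≤ a → a < b → a < d → d ≤ b → Bad a b c d
  bad-3412 : d ≤ a → a < b → c < d → Bad a b c d

Avoids : List ℕ → Set
Avoids w = ∀ {a b c d} → (a ∷ b ∷ c ∷ d ∷ []) ⊆ w → ¬ Bad a b c d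

Avoids-⊆ : xs ⊆ ys → Avoids ys → Avoids xs
Avoids-⊆ s av t = av (⊆-trans t s)

Bad⇒a<b : ∀ {a b c d} → Bad a b c d → a < b
Bad⇒a<b (bad-2341 _ a<b _)   = a<b
Bad⇒a<b (bad-2413 _ a<b _ _) = a<b
Bad⇒a<b (bad-3412 _ a<b _)   = a<b

-- With `¬Bad-ab<d` this expresses that the patterns are sum indecomposable: a cut after one or two
-- letters puts `c` and `d` above `a`, a cut after three puts `d` above `a` and `b`.
¬Bad-a<cd : ∀ {a b c d} → Bad a b c d → a < c → ¬ (a < d)
¬Bad-a<cd (bad-2341 d≤a _ _)   _   a<d = ℕ.≤⇒≯ d≤a a<d
¬Bad-a<cd (bad-2413 c≤a _ _ _) a<c _   = ℕ.≤⇒≯ c≤a a<c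
¬Bad-a<cd (bad-3412 d≤a _ _)   _   a<d = ℕ.≤⇒≯ d≤a a<d

¬Bad-ab<d : ∀ {a b c d} → Bad a b c d → a < d → ¬ (b < d)
¬Bad-ab<d (bad-2341 d≤a _ _)   a<d _   = ℕ.≤⇒≯ d≤a a<d
¬Bad-ab<d (bad-2413 _ _ _ d≤b) _   b<d = ℕ.≤⇒≯ d≤b b<d
¬Bad-ab<d (bad-3412 d≤a _ _)   a<d _   = ℕ.≤⇒≯ d≤a a<d

-- The endings 341, 413 and 412 all contain a rise, so a decreasing suffix of a word contributes at
-- most two letters to an occurrence.
¬Bad-b>c>d : ∀ {a b c d} → Bad a b c d → c < b → ¬ (d < c)
¬Bad-b>c>d (bad-2341 _ _ b<c)     c<b _   = ℕ.<-asym b<c c<b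
¬Bad-b>c>d (bad-2413 c≤a _ a<d _) _   d<c = ℕ.<⇒≱ a<d (ℕ.≤-trans (ℕ.<⇒≤ d<c) c≤a)
¬Bad-b>c>d (bad-3412 _ _ c<d)     _   d<c = ℕ.<-asym c<d d<c

Avoids-++ : Avoids xs → Avoids ys → (∀ {x y} → x ∈ xs → y ∈ ys → x < y) → Avoids (xs ++ ys)
Avoids-++ {xs = xs} avx avy lt s bad with ++-split-⊆ xs s
... | []                     , _ , refl , _  , s₂ = avy s₂ bad
... | _ ∷ []                 , _ , refl , s₁ , s₂ =
  ¬Bad-a<cd bad (lt (Sub.lookup s₁ (here refl)) (Sub.lookup s₂ (there (here refl))))
                (lt (Sub.lookup s₁ (here refl)) (Sub.lookup s₂ (there (there (here refl)))))
... | _ ∷ _ ∷ []             , _ , refl , s₁ , s₂ =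
  ¬Bad-a<cd bad (lt (Sub.lookup s₁ (here refl)) (Sub.lookup s₂ (here refl)))
                (lt (Sub.lookup s₁ (here refl)) (Sub.lookup s₂ (there (here refl))))
... | _ ∷ _ ∷ _ ∷ []         , _ , refl , s₁ , s₂ =
  ¬Bad-ab<d bad (lt (Sub.lookup s₁ (here refl)) (Sub.lookup s₂ (here refl)))
                (lt (Sub.lookup s₁ (there (here refl))) (Sub.lookup s₂ (here refl)))
... | _ ∷ _ ∷ _ ∷ _ ∷ []     , [] , refl , s₁ , _ = avx s₁ bad
... | _ ∷ _ ∷ _ ∷ _ ∷ _ ∷ _  , _ , () , _

Avoids-max∷ : (∀ {x} → x ∈ xs → x < a) → Avoids xs → Avoids (a ∷ xs)
Avoids-max∷ lt av (_ ∷ʳ s)   bad = av s bad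
Avoids-max∷ lt av (refl ∷ s) bad = ℕ.<-asym (Bad⇒a<b bad) (lt (Sub.lookup s (here refl)))

Decreasing : List ℕ → Set
Decreasing = AllPairs _>_

Avoids-Decreasing : Decreasing w → Avoids w
Avoids-Decreasing dec s bad =
  ℕ.<-asym (Bad⇒a<b bad) (AllPairs-lookup dec (⊆-trans (refl ∷ refl ∷ minimum _) s))

Separated : List ℕ → List ℕ → Set
Separated M l = AllPairs (λ x y → x < y → All (x <_) l) M

-- An occurrence is sorted by the number of its letters in `M`; the others lie in the decreasing
-- word `u ++ l`. The letter `a` can only come first, and then the larger second letter is outside
-- `M`, so three decreasing letters would follow.
Avoids-block : ∀ {M u l} → (∀ {x} → x ∈ M ++ l → x < a) → (∀ {x} → x ∈ u → a < x) →
  Decreasing u → Decreasing l → Separated M l → Avoids (M ++ l) → Avoids (a ∷ M ++ u ++ l)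
Avoids-block {a} {M} {u} {l} <a a< du dl sep av = main
  where
  D : Decreasing (u ++ l)
  D = AllPairs.++⁺ du dl (All.tabulate λ x∈u → All.tabulate λ y∈l →
        ℕ.<-trans (<a (∈-++⁺ʳ M y∈l)) (a< x∈u))

  <u : ∀ {x y} → x ∈ M → y ∈ u → x < y
  <u x∈M y∈u = ℕ.<-trans (<a (∈-++⁺ˡ x∈M)) (a< y∈u)

  inner : Avoids (M ++ u ++ l)
  inner s bad with ++-split-⊆ M s
  ... | [] , _ , refl , _ , s₂ = Avoids-Decreasing D s₂ bad
  ... | _ ∷ [] , _ , refl , _ , s₂ =
    ¬Bad-b>c>d bad (AllPairs-lookup D (⊆-trans (refl ∷ refl ∷ _ ∷ʳ []) s₂))
                   (AllPairs-lookup D (⊆-trans (_ ∷ʳ refl ∷ refl ∷ []) s₂))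
  ... | _ ∷ _ ∷ _ ∷ [] , _ , refl , s₁ , s₂ = case ∈-++⁻ u (Sub.lookup s₂ (here refl)) of λ
    { (inj₁ d∈u) → ¬Bad-ab<d bad (<u (Sub.lookup s₁ (here refl)) d∈u)
                                 (<u (Sub.lookup s₁ (there (here refl))) d∈u)
    ; (inj₂ d∈l) → av (Subₚ.++⁺ s₁ (from∈ d∈l)) bad }
  ... | _ ∷ _ ∷ _ ∷ _ ∷ [] , [] , refl , s₁ , _ = av (Subₚ.++⁺ʳ l s₁) bad
  ... | _ ∷ _ ∷ _ ∷ _ ∷ _ ∷ _  , _ , () , _
  -- The patterns 2413 and 3412 end in a rise, impossible in `u ++ l`. In 2341 the last letter is
  -- too small for `u`, and in `l` it would contradict `sep`.
  ... | _ ∷ _ ∷ [] , _ , refl , s₁ , s₂ = case bad of λ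
    { (bad-2413 c≤a _ a<d _) → ℕ.<⇒≱ (ℕ.≤-<-trans c≤a a<d) (ℕ.<⇒≤ (AllPairs-lookup D s₂))
    ; (bad-3412 _ _ c<d)     → ℕ.<-asym c<d (AllPairs-lookup D s₂)
    ; (bad-2341 d≤a a<b _)   → case ∈-++⁻ u (Sub.lookup s₂ (there (here refl))) of λ
      { (inj₁ d∈u) → ℕ.≤⇒≯ d≤a (<u (Sub.lookup s₁ (here refl)) d∈u)
      ; (inj₂ d∈l) → ℕ.≤⇒≯ d≤a (All.lookup (AllPairs-lookup sep s₁ a<b) d∈l) } }

  main : Avoids (a ∷ M ++ u ++ l)
  main (_ ∷ʳ s)   bad = inner s bad
  main (refl ∷ s) bad with ++-split-⊆ M s
  ... | []    , _ , refl , _  , s₂ =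
    ¬Bad-b>c>d bad (AllPairs-lookup D (⊆-trans (refl ∷ refl ∷ _ ∷ʳ []) s₂))
                   (AllPairs-lookup D (⊆-trans (_ ∷ʳ refl ∷ refl ∷ []) s₂))
  ... | _ ∷ _ , _ , eq   , s₁ , _  = ℕ.<-asym (Bad⇒a<b bad)
    (subst (_< a) (sym (∷-injectiveˡ eq)) (<a (∈-++⁺ˡ (Sub.lookup s₁ (here refl)))))

-- Decomposition of the avoiders

Empty : Structure (List ℕ)
Empty lo hi w = w ≡ [] × lo ≡ hi

F : Structure (List ℕ)
F lo hi w = Perm lo hi w × Avoids w

-- The gap in M ++ l is a place where a new maximum can be inserted.
C : Structure (List ℕ × List ℕ)
C lo hi (M , l) = F lo hi (M ++ l) × l ≢ [] × Decreasing l × Separated M l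

U : Structure (List ℕ)
U lo hi u = lo < hi × Perm lo hi u × Decreasing u

V : Structure (ℕ × ⊤ × List ℕ)
V = Single ⊗ U

Max∷ : ℕ × List ℕ × ⊤ → List ℕ
Max∷ (a , w , _) = a ∷ w

Block : ℕ × (List ℕ × List ℕ) × (ℕ × ⊤ × List ℕ) → List ℕ
Block (a , (M , l) , (_ , _ , u)) = a ∷ M ++ u ++ l

IndA IndB Ind : Structure (List ℕ)
IndA = Image Max∷ (F ⊗ Single)
IndB = Image Block (C ⊗ V)
Ind  = IndA ∪ IndB

Sum : ℕ × List ℕ × List ℕ → List ℕ
Sum (_ , p , v) = p ++ v

F-[] : F lo lo []
F-[] = Perm-[] , λ ()

F-++ : F lo mid xs → F mid hi ys → F lo hi (xs ++ ys)
F-++ (p , avp) (q , avq) = Perm-++ p q ,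
  Avoids-++ avp avq (λ x∈ y∈ → ℕ.<-≤-trans (proj₂ (bounds p x∈)) (proj₁ (bounds q y∈)))

F-max∷ : F lo a w → F lo (suc a) (a ∷ w)
F-max∷ {w = w} (p , av) =
  Perm-resp-↭ (↭ₚ.++-comm w _) (Perm-++ p Perm-singleton) , Avoids-max∷ (proj₂ ∘ bounds p) av

F-block : C lo a (M , l) → U (suc a) hi u → F lo hi (a ∷ M ++ u ++ l)
F-block {a = a} {M} {l} {u = u} ((p , av) , _ , dl , sep) (_ , q , du) =
  Perm-resp-↭ perm (Perm-++ p (Perm-++ Perm-singleton q)) ,
  Avoids-block (proj₂ ∘ bounds p) (proj₁ ∘ bounds q) du dl sep av
  where
  perm : (M ++ l) ++ a ∷ u ↭ a ∷ M ++ u ++ l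
  perm = ↭-trans (↭-reflexive (++-assoc M l (a ∷ u)))
        (↭-trans (↭ₚ.++⁺ˡ M (↭ₚ.++-comm l (a ∷ u))) (↭ₚ.shift a M (u ++ l)))

Ind⇒F : Ind lo hi p → F lo hi p
Ind⇒F (inj₁ (_ , (_ , _ , f , refl) , refl)) = F-max∷ f
Ind⇒F (inj₂ (_ , (_ , _ , c , (_ , _ , refl , u)) , refl)) = F-block c u

-- The common letter is the last one of the whole word.
suffixes-meet : ∀ q s {l t : List A} → q ++ l ≡ s ++ t → l ≢ [] → t ≢ [] → ∃ λ y → y ∈ l × y ∈ t
suffixes-meet q s {l} {t} eq l≢[] t≢[] with initLast l | initLast t
... | []       | _        = contradiction refl l≢[]
... | _ ∷ʳ′ _  | []       = contradiction refl t≢[]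
... | l′ ∷ʳ′ y | t′ ∷ʳ′ z with ∷ʳ-injectiveʳ (q ++ l′) (s ++ t′)
        (trans (++-assoc q l′ _) (trans eq (sym (++-assoc s t′ _))))
... | refl = y , ∈-++⁺ʳ l′ (here refl) , ∈-++⁺ʳ t′ (here refl)

-- The witness in a suffix is the last letter of `p`: it is at most the maximum `a` in the first
-- form and belongs to `l`, below `a`, in the second. Uniqueness of the sum decomposition uses no
-- other trace of indecomposability.
Ind-suffix : Ind lo hi p → ∃₂ λ a p′ → p ≡ a ∷ p′ × a ∈ p ×
  (∀ s {t} → p ≡ s ++ t → t ≢ [] → ∃ λ y → y ∈ t × y ≤ a)
Ind-suffix (inj₁ ((a , w , _) , (_ , _ , (perm , _) , refl) , refl)) =
  a , w , refl , here refl , λ s eq t≢[] → case suffixes-meet [] s eq (λ ()) t≢[] of λ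
    { (_ , here refl , y∈t) → _ , y∈t , ℕ.≤-refl
    ; (_ , there y∈w , y∈t) → _ , y∈t , ℕ.<⇒≤ (proj₂ (bounds perm y∈w)) }
Ind-suffix (inj₂ ((a , (M , l) , (_ , _ , u)) , (_ , _ , ((perm , _) , l≢[] , _) , _) , refl)) =
  a , M ++ u ++ l , refl , here refl , λ s eq t≢[] →
    case suffixes-meet (a ∷ M ++ u) s (trans (++-assoc (a ∷ M) u l) eq) l≢[] t≢[] of λ
    { (y , y∈l , y∈t) → y , y∈t , ℕ.<⇒≤ (proj₂ (bounds perm (∈-++⁺ʳ M y∈l))) }

++-compare : ∀ (xs xs′ : List A) {ys ys′} → xs ++ ys ≡ xs′ ++ ys′ →
  (∃ λ q → xs′ ≡ xs ++ q × ys ≡ q ++ ys′) ⊎ (∃ λ q → xs ≡ xs′ ++ q × ys′ ≡ q ++ ys)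
++-compare []       xs′       eq = inj₁ (xs′ , refl , eq)
++-compare (x ∷ xs) []        eq = inj₂ (x ∷ xs , refl , sym eq)
++-compare (x ∷ xs) (x′ ∷ xs′) eq with ∷-injective eq
... | refl , eq′ with ++-compare xs xs′ eq′
... | inj₁ (q , eq₁ , eq₂) = inj₁ (q , cong (x ∷_) eq₁ , eq₂)
... | inj₂ (q , eq₁ , eq₂) = inj₂ (q , cong (x ∷_) eq₁ , eq₂)

-- A nonempty `q` would contain a letter at most `a`, the common first letter of `p` and `p′`,
-- whereas `q` starts at `mid`, above `a`.
Ind-no-extension : Ind lo mid p → Ind lo mid′ p′ → (∀ {y} → y ∈ q → mid ≤ y) → p′ ≡ p ++ q → q ≡ []
Ind-no-extension {q = []}            _ _  _   _    = refl
Ind-no-extension {p = p} {q = _ ∷ _} i i′ mid≤ refl with Ind-suffix i | Ind-suffix i′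
... | a , _ , refl , a∈p , _ | _ , _ , refl , _ , suffix with suffix p refl (λ ())
... | y , y∈q , y≤a =
  contradiction (ℕ.<-≤-trans (proj₂ (bounds (proj₁ (Ind⇒F i)) a∈p)) (mid≤ y∈q)) (ℕ.≤⇒≯ y≤a)

-- One of `p`, `p′` is a prefix of the other, and the excess is a prefix of the upper part `xs` or
-- `ys`, hence lies above the shorter one.
Ind-++-injective : Ind lo mid p → Ind lo mid′ p′ → Perm mid hi xs → Perm mid′ hi ys →
  p ++ xs ≡ p′ ++ ys → mid ≡ mid′ × p ≡ p′ × xs ≡ ys
Ind-++-injective {p = p} {p′ = p′} {xs = xs} {ys = ys} i i′ permxs permys eq =
  case same of λ { refl →
    let _ , _ , _ , a∈ , _ = Ind-suffix i in
    Perm-hi-unique a∈ (proj₁ (Ind⇒F i)) (proj₁ (Ind⇒F i′)) , refl , ++-cancelˡ p _ _ eq }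
  where
  same : p ≡ p′
  same with ++-compare p p′ eq
  ... | inj₁ (q , eq₁ , refl)
    with refl ← Ind-no-extension i i′ (λ y∈ → proj₁ (bounds permxs (∈-++⁺ˡ y∈))) eq₁
    = sym (trans eq₁ (++-identityʳ p))
  ... | inj₂ (q , eq₁ , refl)
    with refl ← Ind-no-extension i′ i (λ y∈ → proj₁ (bounds permys (∈-++⁺ˡ y∈))) eq₁
    = trans eq₁ (++-identityʳ p′)

data Head (P : A → Set) : List A → Set where
  head : ∀ {x xs} → P x → Head P (x ∷ xs)

split : {P : A → Set} → Decidable P → ∀ xs →
  ∃₂ λ ys zs → xs ≡ ys ++ zs × All P ys × (zs ≡ [] ⊎ Head (¬_ ∘ P) zs)
split P? []       = [] , [] , refl , [] , inj₁ refl
split P? (x ∷ xs) with P? x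
... | no ¬p = [] , x ∷ xs , refl , [] , inj₂ (head ¬p)
... | yes p with split P? xs
... | ys , zs , refl , ps , end = x ∷ ys , zs , refl , p ∷ ps , end

split-unique : {P : A → Set} {xs xs′ ys ys′ : List A} → All P xs → All P xs′ →
  Head (¬_ ∘ P) ys → Head (¬_ ∘ P) ys′ → xs ++ ys ≡ xs′ ++ ys′ → xs ≡ xs′ × ys ≡ ys′
split-unique []       []       _         _         eq   = refl , eq
split-unique []       (p ∷ _)  (head ¬p) _         refl = contradiction p ¬p
split-unique (p ∷ _)  []       _         (head ¬p) refl = contradiction p ¬p
split-unique (_ ∷ ps) (_ ∷ qs) h         h′        eq with ∷-injective eq
... | refl , eq′ with split-unique ps qs h h′ eq′
... | refl , eq″ = refl , eq″

All⇒Head : {P : A → Set} {xs : List A} → xs ≢ [] → All P xs → Head P xs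
All⇒Head xs≢[] []      = contradiction refl xs≢[]
All⇒Head _     (p ∷ _) = head p

Head-++ : {P : A → Set} {xs ys : List A} → Head P xs → Head P (xs ++ ys)
Head-++ (head p) = head p

U-nonempty : U lo hi u → u ≢ []
U-nonempty (lo<hi , perm , _) refl = case full perm ℕ.≤-refl lo<hi of λ ()

-- `M` is the maximal initial run below `a` and `u` the maximal run above `a` after it; since `u`
-- and `l` are nonempty, their heads show where these runs stop.
Block-injective : ∀ {M′ l′ u′ hi′} → C lo a (M , l) → U (suc a) hi u → C lo a (M′ , l′) → U (suc a) hi′ u′ →
  M ++ u ++ l ≡ M′ ++ u′ ++ l′ → M ≡ M′ × u ≡ u′ × l ≡ l′
Block-injective {a = a} c u c′ u′ eq =
  let eqM , eq′ = split-unique (M< c) (M< c′) (u-head u) (u-head u′) eq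
      equ , eql = split-unique (u> u) (u> u′) (l-head c) (l-head c′) eq′
  in eqM , equ , eql
  where
  M< : ∀ {lo M l} → C lo a (M , l) → All (_< a) M
  M< ((perm , _) , _) = All.tabulate λ x∈ → proj₂ (bounds perm (∈-++⁺ˡ x∈))
  u> : ∀ {hi u} → U (suc a) hi u → All (a <_) u
  u> (_ , perm , _) = All.tabulate λ x∈ → proj₁ (bounds perm x∈)
  u-head : ∀ {hi u l} → U (suc a) hi u → Head (λ x → ¬ (x < a)) (u ++ l)
  u-head u@(_ , perm , _) = Head-++ (All⇒Head (U-nonempty u) (All.map (λ a<x → ℕ.<-asym a<x) (u> u)))
  l-head : ∀ {lo M l} → C lo a (M , l) → Head (λ x → ¬ (a < x)) l
  l-head {M = M} ((perm , _) , l≢[] , _) =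
    All⇒Head l≢[] (All.tabulate λ x∈ → ℕ.<-asym (proj₂ (bounds perm (∈-++⁺ʳ M x∈))))

decompose-A : Perm lo hi (a ∷ M ++ u) → Avoids (a ∷ M ++ u) → All (_< a) M → All (a <_) u →
  Image Sum (Ind ⊗ F) lo hi (a ∷ M ++ u)
decompose-A {lo} {hi} {a} {M} {u} perm av M<a a<u =
  let lo≤a , a<hi = bounds perm (here refl)
      permM , rest = Perm-split lo≤a (ℕ.<⇒≤ a<hi) (All.lookup M<a)
        (λ { (here refl) → ℕ.≤-refl ; (there x∈u) → ℕ.<⇒≤ (All.lookup a<u x∈u) })
        (Perm-resp-↭ (↭-sym (↭ₚ.shift a M u)) perm)
      _ , permu = Perm-split (ℕ.n≤1+n a) a<hi (λ { (here refl) → ℕ.n<1+n a }) (All.lookup a<u) rest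
  in (suc a , a ∷ M , u) ,
     (ℕ.m≤n⇒m≤1+n lo≤a , a<hi ,
      inj₁ ((a , M , tt) , (lo≤a , ℕ.n≤1+n a , (permM , Avoids-⊆ (a ∷ʳ Subₚ.++⁺ʳ u ⊆-refl) av) , refl) , refl) ,
      permu , Avoids-⊆ (a ∷ʳ Subₚ.++⁺ˡ M ⊆-refl) av) ,
     refl

-- The head of `v` lies above `a`, hence above `x`; a later letter below `a` would complete `a`, `x`
-- and that head to 2341.
stays-above : ∀ {x} → a < x → (∀ {z} → z ∈ v → a ≢ z) → (∀ {z} → z ∈ v → a < z → x < z) →
  Avoids (a ∷ x ∷ v) → v ≡ [] ⊎ Head (λ z → ¬ (z < a)) v → ∀ {z} → z ∈ v → a < z
stays-above a<x a≢ x<v av (inj₂ (head v₀≮a)) (here refl) = ℕ.≤∧≢⇒< (ℕ.≮⇒≥ v₀≮a) (a≢ (here refl))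
stays-above {a} a<x a≢ x<v av (inj₂ (head v₀≮a)) {z} (there z∈) with a <? z
... | yes a<z = a<z
... | no  a≮z = contradiction
  (bad-2341 (ℕ.≮⇒≥ a≮z) a<x (x<v (here refl) (ℕ.≤∧≢⇒< (ℕ.≮⇒≥ v₀≮a) (a≢ (here refl)))))
  (av (refl ∷ refl ∷ refl ∷ from∈ z∈))

-- Every property of the block is forced by one pattern. A rise in `u′` gives 2341 between `a` and
-- `y₀`; a rise in `l′` gives 3412 after `a` and `x₀`; a violation of separation gives 2341 with
-- `x₀` as its 4; a letter of `v` between `a` and a letter of `u′` gives 2413 with `y₀` as its 1.
decompose-B : ∀ {x y} → let u′ = x ∷ u ; l′ = y ∷ l in
  Perm lo hi (a ∷ M ++ u′ ++ l′ ++ v) → Avoids (a ∷ M ++ u′ ++ l′ ++ v) →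
  All (_< a) M → All (a <_) u′ → All (_< a) l′ → v ≡ [] ⊎ Head (λ z → ¬ (z < a)) v →
  Image Sum (Ind ⊗ F) lo hi (a ∷ M ++ u′ ++ l′ ++ v)
decompose-B {u} {l} {lo} {hi} {a} {M} {v} {x₀} {y₀} perm av M<a a<u l<a end =
  -- `u′` turns out to be decreasing, so `x₀` is the maximum of the block and the cut comes right
  -- after it.
  (suc x₀ , a ∷ M ++ u′ ++ l′ , v) ,
  (ℕ.m≤n⇒m≤1+n (ℕ.≤-trans lo≤a a≤x₀) , x₀<hi ,
   inj₂ ((a , (M , l′) , (suc a , tt , u′)) ,
     (lo≤a , ℕ.m≤n⇒m≤1+n a≤x₀ ,
      ((permMl , Avoids-⊆ (a ∷ʳ Subₚ.++⁺ (⊆-refl {x = M}) (Subₚ.++⁺ˡ u′ (Subₚ.++⁺ʳ v ⊆-refl))) av) ,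
       (λ ()) , dec-l , sep) ,
      (ℕ.n≤1+n a , s≤s a≤x₀ , refl , s≤s a<x₀ , permu , dec-u)) , refl) ,
   permv , Avoids-⊆ (a ∷ʳ Subₚ.++⁺ˡ M (Subₚ.++⁺ˡ u′ (Subₚ.++⁺ˡ l′ ⊆-refl))) av) ,
  cong (a ∷_) (sym (trans (++-assoc M (u′ ++ l′) v) (cong (M ++_) (++-assoc u′ l′ v))))
  where
  u′ = x₀ ∷ u
  l′ = y₀ ∷ l

  rest = M ++ u′ ++ l′ ++ v

  in-u : ∀ {x} → x ∈ u′ → x ∈ rest
  in-u x∈ = ∈-++⁺ʳ M (∈-++⁺ˡ x∈)

  in-v : ∀ {x} → x ∈ v → x ∈ rest
  in-v x∈ = ∈-++⁺ʳ M (∈-++⁺ʳ u′ (∈-++⁺ʳ l′ x∈))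

  a≢ : ∀ {x} → x ∈ rest → a ≢ x
  a≢ = All.lookup (AllPairs.head (unique perm))

  lo≤a = proj₁ (bounds perm (here refl))
  a<x₀ = All.lookup a<u (here refl)
  a≤x₀ = ℕ.<⇒≤ a<x₀
  x₀<hi = proj₂ (bounds perm (there (in-u (here refl))))
  y₀≤a = ℕ.<⇒≤ (All.lookup l<a (here refl))

  u<v : ∀ {x z} → x ∈ u′ → z ∈ v → a < z → x < z
  u<v {x} {z} x∈ z∈ a<z with x <? z
  ... | yes x<z = x<z
  ... | no  x≮z = contradiction
    (bad-2413 y₀≤a (All.lookup a<u x∈) a<z (ℕ.≮⇒≥ x≮z))
    (av (refl ∷ Subₚ.++⁺ˡ M (Subₚ.++⁺ (from∈ x∈) (refl ∷ Subₚ.++⁺ˡ l (from∈ z∈)))))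

  a<v : ∀ {z} → z ∈ v → a < z
  a<v = stays-above a<x₀ (a≢ ∘ in-v) (u<v (here refl))
    (Avoids-⊆ (refl ∷ Subₚ.++⁺ˡ M (refl ∷ Subₚ.++⁺ˡ u (Subₚ.++⁺ˡ l′ ⊆-refl))) av) end

  x₀<v : ∀ {z} → z ∈ v → x₀ < z
  x₀<v z∈ = u<v (here refl) z∈ (a<v z∈)

  dec-u : Decreasing u′
  dec-u = AllPairs-tabulate λ {x} {y} s → case y <? x of λ
    { (yes y<x) → y<x
    ; (no  y≮x) → contradiction
        (bad-2341 y₀≤a (All.lookup a<u (Sub.lookup s (here refl)))
          (ℕ.≤∧≢⇒< (ℕ.≮⇒≥ y≮x) (AllPairs-lookup (AllPairs-resp-⊆ (Subₚ.++⁺ʳ _ ⊆-refl)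
            (AllPairs-resp-⊆ (Subₚ.++⁺ˡ M ⊆-refl) (AllPairs.tail (unique perm)))) s)))
        (av (refl ∷ Subₚ.++⁺ˡ M (Subₚ.++⁺ s (refl ∷ minimum _)))) }

  dec-l : Decreasing l′
  dec-l = AllPairs-tabulate λ {x} {y} s → case y <? x of λ
    { (yes y<x) → y<x
    ; (no  y≮x) → contradiction
        (bad-3412 (ℕ.<⇒≤ (All.lookup l<a (Sub.lookup s (there (here refl))))) a<x₀
          (ℕ.≤∧≢⇒< (ℕ.≮⇒≥ y≮x) (AllPairs-lookup (AllPairs-resp-⊆ (Subₚ.++⁺ʳ v ⊆-refl)
            (AllPairs-resp-⊆ (Subₚ.++⁺ˡ M (Subₚ.++⁺ˡ u′ ⊆-refl)) (AllPairs.tail (unique perm)))) s)))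
        (av (refl ∷ Subₚ.++⁺ˡ M (refl ∷ Subₚ.++⁺ˡ u (Subₚ.++⁺ʳ v s)))) }

  sep : Separated M l′
  sep = AllPairs-tabulate λ {x} {y} s x<y → All.tabulate λ {z} z∈ → case x <? z of λ
    { (yes x<z) → x<z
    ; (no  x≮z) → contradiction
        (bad-2341 (ℕ.≮⇒≥ x≮z) x<y (ℕ.<-trans (All.lookup M<a (Sub.lookup s (there (here refl)))) a<x₀))
        (av (a ∷ʳ Subₚ.++⁺ s (refl ∷ Subₚ.++⁺ˡ u (Subₚ.++⁺ʳ v (from∈ z∈))))) }

  -- The parts are regrouped by value, so that `Perm-split` can assign them consecutive intervals.
  sorted : a ∷ M ++ u′ ++ l′ ++ v ↭ (M ++ l′) ++ (a ∷ u′) ++ v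
  sorted = ↭-trans (↭-sym (↭ₚ.shift a M (u′ ++ l′ ++ v)))
          (↭-trans (↭ₚ.++⁺ˡ M (↭ₚ.shifts (a ∷ u′) l′))
                   (↭-reflexive (sym (++-assoc M l′ _))))

  perms₁ = Perm-split lo≤a (ℕ.≤-trans a≤x₀ (ℕ.<⇒≤ x₀<hi))
    (λ x∈ → case ∈-++⁻ M x∈ of λ
      { (inj₁ x∈M) → All.lookup M<a x∈M ; (inj₂ x∈l) → All.lookup l<a x∈l })
    (λ { (here refl) → ℕ.≤-refl ; (there x∈) → case ∈-++⁻ u′ x∈ of λ
      { (inj₁ x∈u) → ℕ.<⇒≤ (All.lookup a<u x∈u) ; (inj₂ x∈v) → ℕ.<⇒≤ (a<v x∈v) } })
    (Perm-resp-↭ sorted perm)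

  permMl = proj₁ perms₁

  perms₂ = Perm-split {xs = a ∷ u′} (ℕ.m≤n⇒m≤1+n a≤x₀) x₀<hi
    (λ { (here refl) → s≤s a≤x₀ ; (there (here refl)) → ℕ.n<1+n x₀
       ; (there (there x∈)) → ℕ.m≤n⇒m≤1+n (All.lookup (AllPairs.head dec-u) x∈) })
    x₀<v (proj₂ perms₁)

  permv = proj₂ perms₂

  permu = proj₂ (Perm-split {xs = [ a ]} (ℕ.n≤1+n a) (s≤s a≤x₀)
    (λ { (here refl) → ℕ.n<1+n a }) (All.lookup a<u) (proj₁ perms₂))

-- After `a` the word is cut into maximal runs below, above and below `a`. If the third is empty,
-- the word ends there: a next letter would be neither below nor above `a`, hence equal to it. If it
-- is nonempty, so is the second, for otherwise the first run would have gone on.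
F-decompose : F lo hi (a ∷ w) → Image Sum (Ind ⊗ F) lo hi (a ∷ w)
F-decompose {lo} {hi} {a} {r} (perm , av)
  with split (_<? a) r
... | M , r₁ , refl , M<a , end₁ with split (a <?_) r₁
... | u , r₂ , refl , a<u , end₂ with split (_<? a) r₂
... | [] , [] , refl , _ , _ = subst (Image Sum (Ind ⊗ F) lo hi) (cong (λ z → a ∷ M ++ z) (sym (++-identityʳ u)))
  (decompose-A (subst (λ z → Perm lo hi (a ∷ M ++ z)) (++-identityʳ u) perm)
               (subst (λ z → Avoids (a ∷ M ++ z)) (++-identityʳ u) av) M<a a<u)
... | [] , x ∷ v , refl , _ , inj₂ (head x≮a) with end₂
...   | inj₂ (head a≮x) = contradiction (ℕ.≤-antisym (ℕ.≮⇒≥ x≮a) (ℕ.≮⇒≥ a≮x))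
          (All.lookup (AllPairs.head (unique perm)) (∈-++⁺ʳ M (∈-++⁺ʳ u (here refl))))
F-decompose {lo} {hi} {a} {r} (perm , av)
    | M , r₁ , refl , M<a , end₁ | u , r₂ , refl , a<u , end₂ | y ∷ l , v , refl , l<a , end₃ with u | end₁
... | []    | inj₂ (head y≮a) = contradiction (All.lookup l<a (here refl)) y≮a
... | x ∷ u | _               = decompose-B perm av M<a a<u l<a end₃

-- Splitting a pair at the first letter of `M`

max∷ : ℕ × (List ℕ × List ℕ) × ⊤ → List ℕ × List ℕ
max∷ (a , (M , l) , _) = a ∷ M , l

ind++ : ℕ × List ℕ × (List ℕ × List ℕ) → List ℕ × List ℕ
ind++ (_ , p , (M , l)) = p ++ M , l

block∷ : ℕ × (List ℕ × List ℕ) × (ℕ × ⊤ × List ℕ) → List ℕ × List ℕ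
block∷ (a , (M , l) , (_ , _ , u)) = a ∷ M , u ++ l

-- Either `M` is empty, or its first letter `a` lies above all of the second component, below all of
-- it, or strictly inside. In the last case the letters above `a` form the prefix `u`, and the
-- underlying word is again a block `a M u l`; this is why `B` recurs in the equation for `C`.
C-start C-max C-ind C-block C-cases : Structure (List ℕ × List ℕ)
C-start = Image ([] ,_) U
C-max   = Image max∷ (C ⊗ Single)
C-ind   = Image ind++ (Ind ⊗ C)
C-block = Image block∷ (C ⊗ V)
C-cases = C-start ∪ C-max ∪ C-ind ∪ C-block

-- Separation is vacuous for a new first letter `a` above `M`, since it starts no rise, and
-- automatic for the letters of an indecomposable prefix, which lie below `l`. In the last case `u`
-- lies above `M`, so only the old condition on `l` remains.
C-compose : C-cases lo hi z → C lo hi z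
C-compose (inj₁ (inj₁ (inj₁ (_ , u@(_ , perm , dec) , refl)))) =
  (perm , Avoids-Decreasing dec) , U-nonempty u , dec , []
C-compose (inj₁ (inj₁ (inj₂ (_ , (_ , _ , (f@(perm , _) , l≢[] , dec , sep) , refl) , refl)))) =
  F-max∷ f , l≢[] , dec ,
  All.tabulate (λ y∈ a<y → contradiction (proj₂ (bounds perm (∈-++⁺ˡ y∈))) (ℕ.<-asym a<y)) ∷ sep
C-compose {hi = hi} (inj₁ (inj₂ ((c , p , (M , l)) , (_ , _ , i , (f@(perm , _) , l≢[] , dec , sep)) , refl))) =
  subst (F _ hi) (sym (++-assoc p M l)) (F-++ (Ind⇒F i) f) , l≢[] , dec ,
  AllPairs.++⁺ (AllPairs-tabulate λ s _ → p<l (Sub.lookup s (here refl))) sep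
    (All.tabulate λ x∈ → All.tabulate λ _ _ → p<l x∈)
  where
  p<l : ∀ {x} → x ∈ p → All (x <_) l
  p<l x∈ = All.tabulate λ z∈ →
    ℕ.<-≤-trans (proj₂ (bounds (proj₁ (Ind⇒F i)) x∈)) (proj₁ (bounds perm (∈-++⁺ʳ M z∈)))
C-compose (inj₂
  ((a , (M , l) , (_ , _ , u)) ,
   (_ , _ , c@((perm , _) , l≢[] , dec , sep) , (_ , _ , refl , ub@(_ , permu , decu))) , refl)) =
  F-block c ub , nonempty u , AllPairs.++⁺ decu dec (All.tabulate λ x∈ → All.tabulate λ y∈ →
    ℕ.<-trans (<a (∈-++⁺ʳ M y∈)) (a<u x∈)) ,
  All.tabulate (λ y∈ a<y → contradiction (<a (∈-++⁺ˡ y∈)) (ℕ.<-asym a<y)) ∷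
  AllPairs-tabulate (λ s x<y → All.++⁺
    (All.tabulate λ z∈ → ℕ.<-trans (<a (∈-++⁺ˡ (Sub.lookup s (here refl)))) (a<u z∈))
    (AllPairs-lookup sep s x<y))
  where
  <a : ∀ {x} → x ∈ M ++ l → x < a
  <a = proj₂ ∘ bounds perm
  a<u : ∀ {x} → x ∈ u → a < x
  a<u = proj₁ ∘ bounds permu
  nonempty : ∀ u → u ++ l ≢ []
  nonempty [] = l≢[]

-- Here `u` is the part of the second component above `a`. If nothing remains, the first sum
-- component of the whole word is split off; otherwise a letter `y` below `a` bounds `M` by `a`,
-- through separation.
C-decompose-rest : C lo hi (a ∷ M , u ++ l) → All (a <_) u → l ≡ [] ⊎ Head (λ x → ¬ (a < x)) l →
  C-cases lo hi (a ∷ M , u ++ l)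
C-decompose-rest {lo} {hi} {a} {M} {u} c a<u (inj₁ refl) with F-decompose (proj₁ c)
... | (mid , p , v) , (lo≤ , ≤hi , i , f) , eq =
  let q , eq₁ , eq₂ = remainder (++-compare (a ∷ M) p eq)
      _ , D≢[] , dec , sep = c
  in inj₁ (inj₂ ((mid , p , (q , u ++ [])) ,
       (lo≤ , ≤hi , i , (subst (F mid hi) eq₂ f , D≢[] , dec ,
         AllPairs-resp-⊆ (subst (q ⊆_) (sym eq₁) (Subₚ.++⁺ˡ p ⊆-refl)) sep)) ,
       cong (_, u ++ []) eq₁))
  where
  -- The component `p` ends inside `a ∷ M`: reaching into `u`, it would have a suffix consisting of
  -- letters above `a`, against `Ind-suffix`.
  remainder : (∃ λ q → p ≡ (a ∷ M) ++ q × u ++ [] ≡ q ++ v) ⊎ (∃ λ q → a ∷ M ≡ p ++ q × v ≡ q ++ u ++ []) →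
    ∃ λ q → a ∷ M ≡ p ++ q × v ≡ q ++ u ++ []
  remainder (inj₂ r)                  = r
  remainder (inj₁ ([] , eq₁ , eq₂))    = [] ,
    trans (sym (++-identityʳ (a ∷ M))) (trans (sym eq₁) (sym (++-identityʳ p))) , sym eq₂
  remainder (inj₁ (x ∷ q , eq₁ , eq₂)) with Ind-suffix i
  ... | _ , _ , p≡ , _ , suffix with suffix (a ∷ M) eq₁ (λ ()) | ∷-injectiveˡ (trans (sym p≡) eq₁)
  ... | y , y∈ , y≤a | refl = contradiction
    (All.lookup a<u (subst (y ∈_) (++-identityʳ u) (subst (y ∈_) (sym eq₂) (∈-++⁺ˡ y∈))))
    (ℕ.≤⇒≯ y≤a)
C-decompose-rest {lo} {hi} {a} {M} {u} {y ∷ l} ((perm , av) , _ , dec , sep) a<u (inj₂ (head a≮y)) =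
  decide u a<u dec-u permau
  where
  D = u ++ y ∷ l

  dec-l : Decreasing (y ∷ l)
  dec-l = AllPairs-resp-⊆ (Subₚ.++⁺ˡ u ⊆-refl) dec

  a≢ : ∀ {x} → x ∈ M ++ D → a ≢ x
  a≢ = All.lookup (AllPairs.head (unique perm))

  y<a : y < a
  y<a = ℕ.≤∧≢⇒< (ℕ.≮⇒≥ a≮y) (a≢ (∈-++⁺ʳ M (∈-++⁺ʳ u (here refl))) ∘ sym)

  -- For a letter of `M` above `a`, the rise from `a` to it would put `y` above `a` by separation.
  <a : ∀ {x} → x ∈ M ++ y ∷ l → x < a
  <a {x} x∈ with ∈-++⁻ M x∈
  ... | inj₂ (here refl) = y<a
  ... | inj₂ (there x∈l) = ℕ.<-trans (All.lookup (AllPairs.head dec-l) x∈l) y<a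
  ... | inj₁ x∈M with a <? x
  ...   | no  a≮x = ℕ.≤∧≢⇒< (ℕ.≮⇒≥ a≮x) (a≢ (∈-++⁺ˡ x∈M) ∘ sym)
  ...   | yes a<x = contradiction
    (All.lookup (All.lookup (AllPairs.head sep) x∈M a<x) (∈-++⁺ʳ u (here refl))) a≮y

  lo≤a = proj₁ (bounds perm (here refl))
  a<hi = proj₂ (bounds perm (here refl))

  sorted : a ∷ M ++ u ++ y ∷ l ↭ (M ++ y ∷ l) ++ a ∷ u
  sorted = ↭-trans (↭-sym (↭ₚ.shift a M D))
          (↭-trans (↭ₚ.++⁺ˡ M (↭ₚ.++-comm (a ∷ u) (y ∷ l)))
                   (↭-reflexive (sym (++-assoc M (y ∷ l) (a ∷ u)))))

  perms = Perm-split lo≤a (ℕ.<⇒≤ a<hi) <a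
    (λ { (here refl) → ℕ.≤-refl ; (there x∈) → ℕ.<⇒≤ (All.lookup a<u x∈) }) (Perm-resp-↭ sorted perm)

  permau : Perm a hi (a ∷ u)
  permau = proj₂ perms

  Cl : C lo a (M , y ∷ l)
  Cl = (proj₁ perms , Avoids-⊆ (a ∷ʳ Subₚ.++⁺ (⊆-refl {x = M}) (Subₚ.++⁺ˡ u ⊆-refl)) av) , (λ ()) , dec-l ,
       AllPairs.map (λ f x<y → All.++⁻ʳ u (f x<y)) (AllPairs.tail sep)

  dec-u : Decreasing u
  dec-u = AllPairs-resp-⊆ (Subₚ.++⁺ʳ (y ∷ l) ⊆-refl) dec

  -- With `u` empty, `a` alone fills the interval from `a` to `hi`, so `a` is the maximum; otherwise
  -- `u` occupies the values from `suc a` on.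
  decide : ∀ u → All (a <_) u → Decreasing u → Perm a hi (a ∷ u) → C-cases lo hi (a ∷ M , u ++ y ∷ l)
  decide [] _ _ permau = inj₁ (inj₁ (inj₂
    ((a , (M , y ∷ l) , tt) , (lo≤a , ℕ.<⇒≤ a<hi , Cl , Perm-hi-unique (here refl) permau Perm-singleton) , refl)))
  decide (x ∷ u) a<u dec-u permau = inj₂
    ((a , (M , y ∷ l) , (suc a , tt , x ∷ u)) ,
     (lo≤a , ℕ.<⇒≤ a<hi , Cl ,
      (ℕ.n≤1+n a , a<hi , refl ,
       ℕ.≤-<-trans (All.lookup a<u (here refl)) (proj₂ (bounds permau (there (here refl)))) ,
       proj₂ (Perm-split {xs = [ a ]} (ℕ.n≤1+n a) a<hi (λ { (here refl) → ℕ.n<1+n a }) (All.lookup a<u) permau) ,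
       dec-u)) , refl)

C-decompose : C lo hi z → C-cases lo hi z
C-decompose {z = [] , D} ((perm , _) , D≢[] , dec , _) with D
... | []    = contradiction refl D≢[]
... | x ∷ D = inj₁ (inj₁ (inj₁ (x ∷ D ,
  (ℕ.≤-<-trans (proj₁ (bounds perm (here refl))) (proj₂ (bounds perm (here refl))) , perm , dec) , refl)))
C-decompose {z = a ∷ M , D} c with split (a <?_) D
... | u , l , refl , a<u , end = C-decompose-rest c a<u end

-- Disjointness of the cases, injectivity, and the resulting counts

Below Above Across : List ℕ × List ℕ → Set
Below  (M , l) = ∃₂ λ a M′ → M ≡ a ∷ M′ × l ≢ [] × All (_< a) l
Above  (M , l) = ∃₂ λ a M′ → M ≡ a ∷ M′ × l ≢ [] × All (a <_) l
Across (M , l) = ∃₂ λ a M′ → M ≡ a ∷ M′ × (∃ λ x → x ∈ l × a < x) × (∃ λ y → y ∈ l × y < a)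

C-max⇒Below : C-max lo hi z → Below z
C-max⇒Below (_ , (_ , _ , ((perm , _) , l≢[] , _) , _) , refl) =
  _ , _ , refl , l≢[] , All.tabulate λ x∈ → proj₂ (bounds perm (∈-++⁺ʳ _ x∈))

C-ind⇒Above : C-ind lo hi z → Above z
C-ind⇒Above ((_ , _ , (M , _)) , (_ , _ , i , ((perm , _) , l≢[] , _)) , refl) with Ind-suffix i
... | a , p′ , refl , a∈ , _ = a , p′ ++ M , refl , l≢[] , All.tabulate λ x∈ →
  ℕ.<-≤-trans (proj₂ (bounds (proj₁ (Ind⇒F i)) a∈)) (proj₁ (bounds perm (∈-++⁺ʳ M x∈)))

U-has : U lo hi u → ∃ λ x → x ∈ u × lo ≤ x
U-has (lo<hi , perm , _) = _ , full perm ℕ.≤-refl lo<hi , ℕ.≤-refl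

nonempty-has : {xs : List A} → xs ≢ [] → ∃ λ x → x ∈ xs
nonempty-has {xs = []}    ne = contradiction refl ne
nonempty-has {xs = x ∷ _} _  = x , here refl

C-block⇒Across : C-block lo hi z → Across z
C-block⇒Across ((_ , (M , _) , (_ , _ , u)) , (_ , _ , ((perm , _) , l≢[] , _) , (_ , _ , refl , ub)) , refl) =
  let x , x∈ , a<x = U-has ub ; y , y∈ = nonempty-has l≢[] in
  _ , _ , refl , (x , ∈-++⁺ˡ x∈ , a<x) , (y , ∈-++⁺ʳ u y∈ , proj₂ (bounds perm (∈-++⁺ʳ M y∈)))

¬Below-Above : Below z → ¬ Above z
¬Below-Above (_ , _ , refl , l≢[] , <a) (_ , _ , refl , _ , a<) with nonempty-has l≢[]
... | _ , x∈ = ℕ.<-asym (All.lookup <a x∈) (All.lookup a< x∈)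

¬Below-Across : Below z → ¬ Across z
¬Below-Across (_ , _ , refl , _ , <a) (_ , _ , refl , (_ , x∈ , a<x) , _) = ℕ.<-asym (All.lookup <a x∈) a<x

¬Above-Across : Above z → ¬ Across z
¬Above-Across (_ , _ , refl , _ , a<) (_ , _ , refl , _ , (_ , y∈ , y<a)) = ℕ.<-asym (All.lookup a< y∈) y<a

-- `C-start` is the case of an empty first component; the other three differ in whether the second
-- component lies below, above or on both sides of the first letter.
Counts-C-cases : ∀ {c u i b} → Counts C c → Counts U u → Counts Ind i → Counts V b →
  Counts C-cases (u ⊕ c ⊛ X ⊕ i ⊛ c ⊕ c ⊛ b)
Counts-C-cases cC cU cInd cV =
  Counts-∪ (C-start ∪ C-max ∪ C-ind) C-block not-block
    (Counts-∪ (C-start ∪ C-max) C-ind not-ind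
      (Counts-∪ C-start C-max (λ { _ _ (_ , _ , refl) (_ , _ , ()) })
        (Counts-Image ([] ,_) U (λ { _ _ _ _ refl → refl }) cU)
        (Counts-Image max∷ (C ⊗ Single) (λ { _ _ _ _ refl → refl }) (Counts-⊗ C Single cC Counts-Single)))
      (Counts-Image ind++ (Ind ⊗ C) ind-injective (Counts-⊗ Ind C cInd cC)))
    (Counts-Image block∷ (C ⊗ V) block-injective (Counts-⊗ C V cC cV))
  where
  not-ind : ∀ lo hi {z} → (C-start ∪ C-max) lo hi z → ¬ C-ind lo hi z
  not-ind _ _ (inj₁ (_ , _ , refl)) i = case C-ind⇒Above i of λ { (_ , _ , () , _) }
  not-ind _ _ (inj₂ m)              i = ¬Below-Above (C-max⇒Below m) (C-ind⇒Above i)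

  not-block : ∀ lo hi {z} → (C-start ∪ C-max ∪ C-ind) lo hi z → ¬ C-block lo hi z
  not-block _ _ (inj₁ (inj₁ (_ , _ , refl))) b = case C-block⇒Across b of λ { (_ , _ , () , _) }
  not-block _ _ (inj₁ (inj₂ m))              b = ¬Below-Across (C-max⇒Below m) (C-block⇒Across b)
  not-block _ _ (inj₂ i)                     b = ¬Above-Across (C-ind⇒Above i) (C-block⇒Across b)

  ind-injective : ∀ lo hi {x y} → (Ind ⊗ C) lo hi x → (Ind ⊗ C) lo hi y → ind++ x ≡ ind++ y → x ≡ y
  ind-injective _ _ {_ , p , (M , l)} {_ , p′ , (M′ , l′)}
    (_ , _ , i , ((perm , _) , _)) (_ , _ , i′ , ((perm′ , _) , _)) eq
    with ,-injective eq
  ... | eq₁ , refl with Ind-++-injective i i′ perm perm′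
          (trans (sym (++-assoc p M l)) (trans (cong (_++ l) eq₁) (++-assoc p′ M′ l)))
  ... | refl , refl , _ with refl ← ++-cancelˡ p M M′ eq₁ = refl

  block-injective : ∀ lo hi {x y} → (C ⊗ V) lo hi x → (C ⊗ V) lo hi y → block∷ x ≡ block∷ y → x ≡ y
  block-injective _ _ {_ , (M , _) , _} (_ , _ , c , (_ , _ , refl , u)) (_ , _ , c′ , (_ , _ , refl , u′)) eq
    with ,-injective eq
  ... | eq₁ , eq₂ with ∷-injective eq₁
  ... | refl , refl with Block-injective c u c′ u′ (cong (M ++_) eq₂)
  ... | _ , refl , refl = refl

Counts-IndB : ∀ {c b} → Counts C c → Counts V b → Counts IndB (c ⊛ b)
Counts-IndB cC cV = Counts-Image Block (C ⊗ V) injective (Counts-⊗ C V cC cV)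
  where
  injective : ∀ lo hi {x y} → (C ⊗ V) lo hi x → (C ⊗ V) lo hi y → Block x ≡ Block y → x ≡ y
  injective _ _ (_ , _ , c , (_ , _ , refl , u)) (_ , _ , c′ , (_ , _ , refl , u′)) eq
    with ∷-injective eq
  ... | refl , eq′ with Block-injective c u c′ u′ eq′
  ... | refl , refl , refl = refl

Counts-Ind : ∀ {f b} → Counts F f → Counts IndB b → Counts Ind (f ⊛ X ⊕ b)
Counts-Ind cF cB = Counts-∪ IndA IndB disjoint
  (Counts-Image Max∷ (F ⊗ Single) (λ { _ _ _ _ refl → refl }) (Counts-⊗ F Single cF Counts-Single)) cB
  where
  -- In `IndA` the first letter is the top value of the interval, whereas in `IndB` the nonempty `u`
  -- lies above it.
  disjoint : ∀ lo hi {p} → IndA lo hi p → ¬ IndB lo hi p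
  disjoint _ _ (_ , (_ , _ , _ , hi≡) , refl) (_ , (_ , _ , _ , (_ , _ , refl , (a<hi , _))) , eq)
    with refl ← ∷-injectiveˡ eq = ℕ.<-irrefl (sym hi≡) a<hi

Counts-Empty : Counts Empty (const (+ 1))
Counts-Empty lo zero    = 1 , refl , Count-singleton [] (refl , sym (ℕ.+-identityʳ lo)) proj₁
Counts-Empty lo (suc n) = 0 , refl , Count-∅ λ (_ , eq) → ℕ.m+1+n≢m lo (sym eq)

Counts-F-cases : ∀ {f i} → Counts F f → Counts Ind i → Counts (Empty ∪ Image Sum (Ind ⊗ F)) (const (+ 1) ⊕ i ⊛ f)
Counts-F-cases cF cInd = Counts-∪ Empty (Image Sum (Ind ⊗ F)) disjoint Counts-Empty
  (Counts-Image Sum (Ind ⊗ F) injective (Counts-⊗ Ind F cInd cF))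
  where
  disjoint : ∀ lo hi {w} → Empty lo hi w → ¬ Image Sum (Ind ⊗ F) lo hi w
  disjoint _ _ (refl , _) (_ , (_ , _ , i , _) , eq) with Ind-suffix i
  ... | _ , _ , refl , _ = case eq of λ ()

  injective : ∀ lo hi {x y} → (Ind ⊗ F) lo hi x → (Ind ⊗ F) lo hi y → Sum x ≡ Sum y → x ≡ y
  injective _ _ (_ , _ , i , (perm , _)) (_ , _ , i′ , (perm′ , _)) eq
    with Ind-++-injective i i′ perm perm′ eq
  ... | refl , refl , refl = refl

F⇒F-cases : ∀ lo hi {w} → F lo hi w → (Empty ∪ Image Sum (Ind ⊗ F)) lo hi w
F⇒F-cases lo hi {[]} (perm , _) = inj₁ (refl , ℕ.≤-antisym (lo≤hi perm) hi≤lo)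
  where
  hi≤lo : hi ≤ lo
  hi≤lo = ℕ.≮⇒≥ λ lo<hi → case full perm ℕ.≤-refl lo<hi of λ ()
F⇒F-cases lo hi {_ ∷ _} f = inj₂ (F-decompose f)

F-cases⇒F : ∀ lo hi {w} → (Empty ∪ Image Sum (Ind ⊗ F)) lo hi w → F lo hi w
F-cases⇒F lo hi (inj₁ (refl , refl)) = F-[]
F-cases⇒F lo hi (inj₂ (_ , (_ , _ , i , f) , refl)) = F-++ (Ind⇒F i) f

-- Decreasing runs and their series

decreasing : ℕ → ℕ → List ℕ
decreasing lo zero    = []
decreasing lo (suc n) = lo ℕ.+ n ∷ decreasing lo n

decreasing-Perm : ∀ lo n → Perm lo (lo ℕ.+ n) (decreasing lo n)
decreasing-Perm lo zero    = subst (λ h → Perm lo h []) (sym (ℕ.+-identityʳ lo)) Perm-[]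
decreasing-Perm lo (suc n) = subst (λ h → Perm lo h (decreasing lo (suc n))) (sym (ℕ.+-suc lo n))
  (Perm-resp-↭ (↭ₚ.++-comm (decreasing lo n) _) (Perm-++ (decreasing-Perm lo n) Perm-singleton))

decreasing-Decreasing : ∀ lo n → Decreasing (decreasing lo n)
decreasing-Decreasing lo zero    = []
decreasing-Decreasing lo (suc n) =
  All.tabulate (λ x∈ → proj₂ (bounds (decreasing-Perm lo n) x∈)) ∷ decreasing-Decreasing lo n

-- Both heads are the maximum of the same set of letters; strictness keeps that maximum out of the
-- tails.
Decreasing-unique : Decreasing xs → Decreasing ys →
  (∀ {x} → x ∈ xs → x ∈ ys) → (∀ {x} → x ∈ ys → x ∈ xs) → xs ≡ ys
Decreasing-unique {[]}     {[]}     _  _  _   _   = refl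
Decreasing-unique {[]}     {_ ∷ _}  _  _  _   ⊇   = case ⊇ (here refl) of λ ()
Decreasing-unique {_ ∷ _}  {[]}     _  _  ⊆   _   = case ⊆ (here refl) of λ ()
Decreasing-unique {x ∷ xs} {y ∷ ys} (x> ∷ dx) (y> ∷ dy) ⊆ ⊇ with
  ℕ.≤-antisym (top y> (⊆ (here refl))) (top x> (⊇ (here refl)))
  where
  top : ∀ {x y ys} → All (y >_) ys → x ∈ y ∷ ys → x ≤ y
  top y> (here refl) = ℕ.≤-refl
  top y> (there x∈)  = ℕ.<⇒≤ (All.lookup y> x∈)
... | refl = cong (x ∷_) (Decreasing-unique dx dy
  (λ z∈ → later x> z∈ (⊆ (there z∈))) (λ z∈ → later y> z∈ (⊇ (there z∈))))
  where
  later : ∀ {z zs ws} → All (x >_) zs → z ∈ zs → z ∈ x ∷ ws → z ∈ ws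
  later x> z∈ (here refl) = contradiction (All.lookup x> z∈) (ℕ.<-irrefl refl)
  later x> z∈ (there z∈′) = z∈′

Uₛ : Series
Uₛ zero    = + 0
Uₛ (suc _) = + 1

Uₛ-equation : Uₛ ≈ X ⊕ X ⊛ Uₛ
Uₛ-equation 0             = refl
Uₛ-equation 1             = refl
Uₛ-equation (suc (suc n)) = sym (cong (λ t → + 0 ℤ.+ t) (X-⊛-suc Uₛ (suc n)))

Counts-U : Counts U Uₛ
Counts-U lo zero    = 0 , refl , Count-∅ λ (lo<lo , _) → ℕ.<-irrefl (sym (ℕ.+-identityʳ lo)) lo<lo
Counts-U lo (suc n) = 1 , refl , Count-singleton (decreasing lo (suc n))
  (ℕ.m<m+n lo (s≤s z≤n) , decreasing-Perm lo (suc n) , decreasing-Decreasing lo (suc n))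
  λ (_ , perm , dec) → Decreasing-unique dec (decreasing-Decreasing lo (suc n))
    (λ x∈ → let lo≤ , <hi = bounds perm x∈ in full (decreasing-Perm lo (suc n)) lo≤ <hi)
    (λ x∈ → let lo≤ , <hi = bounds (decreasing-Perm lo (suc n)) x∈ in full perm lo≤ <hi)

-- Translations

shift : ℕ → List ℕ → List ℕ
shift k = map (k ℕ.+_)

⊆-map⁻ : {B : Set} (f : A → B) (xs : List A) {zs : List B} → zs ⊆ map f xs → ∃ λ ys → zs ≡ map f ys × ys ⊆ xs
⊆-map⁻ f []       []         = [] , refl , []
⊆-map⁻ f (x ∷ xs) (_ ∷ʳ s)   = let ys , eq , t = ⊆-map⁻ f xs s in ys , eq , x ∷ʳ t
⊆-map⁻ f (x ∷ xs) (refl ∷ s) = let ys , eq , t = ⊆-map⁻ f xs s in x ∷ ys , cong (f x ∷_) eq , refl ∷ t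

Bad-shift⁺ : ∀ k {a b c d} → Bad a b c d → Bad (k ℕ.+ a) (k ℕ.+ b) (k ℕ.+ c) (k ℕ.+ d)
Bad-shift⁺ k (bad-2341 p q r)   = bad-2341 (ℕ.+-monoʳ-≤ k p) (ℕ.+-monoʳ-< k q) (ℕ.+-monoʳ-< k r)
Bad-shift⁺ k (bad-2413 p q r s) =
  bad-2413 (ℕ.+-monoʳ-≤ k p) (ℕ.+-monoʳ-< k q) (ℕ.+-monoʳ-< k r) (ℕ.+-monoʳ-≤ k s)
Bad-shift⁺ k (bad-3412 p q r)   = bad-3412 (ℕ.+-monoʳ-≤ k p) (ℕ.+-monoʳ-< k q) (ℕ.+-monoʳ-< k r)

Bad-shift⁻ : ∀ k {a b c d} → Bad (k ℕ.+ a) (k ℕ.+ b) (k ℕ.+ c) (k ℕ.+ d) → Bad a b c d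
Bad-shift⁻ k (bad-2341 p q r)   =
  bad-2341 (ℕ.+-cancelˡ-≤ k _ _ p) (ℕ.+-cancelˡ-< k _ _ q) (ℕ.+-cancelˡ-< k _ _ r)
Bad-shift⁻ k (bad-2413 p q r s) = bad-2413 (ℕ.+-cancelˡ-≤ k _ _ p) (ℕ.+-cancelˡ-< k _ _ q)
  (ℕ.+-cancelˡ-< k _ _ r) (ℕ.+-cancelˡ-≤ k _ _ s)
Bad-shift⁻ k (bad-3412 p q r)   =
  bad-3412 (ℕ.+-cancelˡ-≤ k _ _ p) (ℕ.+-cancelˡ-< k _ _ q) (ℕ.+-cancelˡ-< k _ _ r)

Avoids-shift⁺ : ∀ k → Avoids w → Avoids (shift k w)
Avoids-shift⁺ {w} k av s bad with ⊆-map⁻ (k ℕ.+_) w s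
... | _ ∷ _ ∷ _ ∷ _ ∷ [] , refl , t = av t (Bad-shift⁻ k bad)

Avoids-shift⁻ : ∀ k → Avoids (shift k w) → Avoids w
Avoids-shift⁻ k av s bad = av (Subₚ.map⁺ (k ℕ.+_) s) (Bad-shift⁺ k bad)

Perm-shift⁺ : ∀ k → Perm 0 n w → Perm k (k ℕ.+ n) (shift k w)
Perm-shift⁺ {n} {w} k (mkPerm _ u b f) = mkPerm (ℕ.m≤m+n k n)
  (Unique.map⁺ (ℕ.+-cancelˡ-≡ k _ _) u)
  (λ x∈ → case ∈-map⁻ (k ℕ.+_) x∈ of λ { (y , y∈ , refl) → ℕ.m≤m+n k y , ℕ.+-monoʳ-< k (proj₂ (b y∈)) })
  (λ {x} k≤x x<k+n → subst (_∈ shift k w) (ℕ.m+[n∸m]≡n k≤x) (∈-map⁺ (k ℕ.+_)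
    (f z≤n (ℕ.+-cancelˡ-< k _ _ (subst (_< k ℕ.+ n) (sym (ℕ.m+[n∸m]≡n k≤x)) x<k+n)))))

Perm-shift⁻ : ∀ k → Perm k (k ℕ.+ n) (shift k w) → Perm 0 n w
Perm-shift⁻ {n} {w} k (mkPerm _ u b f) = mkPerm z≤n (Unique.map⁻ u)
  (λ x∈ → z≤n , ℕ.+-cancelˡ-< k _ _ (proj₂ (b (∈-map⁺ (k ℕ.+_) x∈))))
  (λ {x} _ x<n → case ∈-map⁻ (k ℕ.+_) (f (ℕ.m≤m+n k x) (ℕ.+-monoʳ-< k x<n)) of λ
    { (y , y∈ , eq) → subst (_∈ w) (sym (ℕ.+-cancelˡ-≡ k _ _ eq)) y∈ })

F-shift⁺ : ∀ k → F 0 n w → F k (k ℕ.+ n) (shift k w)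
F-shift⁺ k (perm , av) = Perm-shift⁺ k perm , Avoids-shift⁺ k av

F-shift⁻ : ∀ k → F k (k ℕ.+ n) (shift k w) → F 0 n w
F-shift⁻ k (perm , av) = Perm-shift⁻ k perm , Avoids-shift⁻ k av

C-shift⁺ : ∀ k → C 0 n (M , l) → C k (k ℕ.+ n) (shift k M , shift k l)
C-shift⁺ {n} {M} {l} k (f , l≢[] , dec , sep) =
  subst (F k (k ℕ.+ n)) (map-++ (k ℕ.+_) M l) (F-shift⁺ k f) , nonempty l l≢[] ,
  AllPairs.map⁺ (AllPairs.map (ℕ.+-monoʳ-< k) dec) ,
  AllPairs.map⁺ (AllPairs.map (λ h x<y → All.map⁺ (All.map (ℕ.+-monoʳ-< k) (h (ℕ.+-cancelˡ-< k _ _ x<y)))) sep)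
  where
  nonempty : ∀ l → l ≢ [] → shift k l ≢ []
  nonempty []      l≢[] _ = l≢[] refl
  nonempty (_ ∷ _) _    ()

C-shift⁻ : ∀ k → C k (k ℕ.+ n) (shift k M , shift k l) → C 0 n (M , l)
C-shift⁻ {n} {M} {l} k (f , l≢[] , dec , sep) =
  F-shift⁻ k (subst (F k (k ℕ.+ n)) (sym (map-++ (k ℕ.+_) M l)) f) , (λ { refl → l≢[] refl }) ,
  AllPairs.map (ℕ.+-cancelˡ-< k _ _) (AllPairs.map⁻ dec) ,
  AllPairs.map (λ h x<y → All.map (ℕ.+-cancelˡ-< k _ _) (All.map⁻ (h (ℕ.+-monoʳ-< k x<y)))) (AllPairs.map⁻ sep)

unshift : ∀ {k} → All (k ≤_) w → ∃ λ w′ → w ≡ shift k w′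
unshift []                = [] , refl
unshift {x ∷ _} {k} (k≤x ∷ ps) = let w′ , eq = unshift ps in
  x ∸ k ∷ w′ , cong₂ _∷_ (sym (ℕ.m+[n∸m]≡n k≤x)) eq

shift-injective : ∀ k {w w′} → shift k w ≡ shift k w′ → w ≡ w′
shift-injective k = map-injective (ℕ.+-cancelˡ-≡ k _ _)

-- The enumeration reaches only intervals that start at 0; translation carries its counts to every
-- left end, as `Counts` demands.
Counts-F : ∀ {f} → (∀ n → ∃ λ k → f n ≡ + k × Count (F 0 n) k) → Counts F f
Counts-F c k n with c n
... | m , eq , cm = m , eq , Count-map {P = F 0 n} (shift k) (λ _ _ → shift-injective k) (F-shift⁺ k) from cm
  where
  from : ∀ {w} → F k (k ℕ.+ n) w → ∃ λ w′ → F 0 n w′ × w ≡ shift k w′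
  from f with unshift (All.tabulate (λ x∈ → proj₁ (bounds (proj₁ f) x∈)))
  ... | w′ , refl = w′ , F-shift⁻ k f , refl

Counts-C : ∀ {f} → (∀ n → ∃ λ k → f n ≡ + k × Count (C 0 n) k) → Counts C f
Counts-C c k n with c n
... | m , eq , cm = m , eq , Count-map {P = C 0 n} shift₂ (λ _ _ → injective) (C-shift⁺ k) from cm
  where
  shift₂ : List ℕ × List ℕ → List ℕ × List ℕ
  shift₂ (M , l) = shift k M , shift k l
  injective : ∀ {x y} → shift₂ x ≡ shift₂ y → x ≡ y
  injective eq = cong₂ _,_ (shift-injective k (cong proj₁ eq)) (shift-injective k (cong proj₂ eq))
  from : ∀ {z} → C k (k ℕ.+ n) z → ∃ λ z′ → C 0 n z′ × z ≡ shift₂ z′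
  from {M , l} c@((perm , _) , _) with unshift {M} (All.tabulate (λ x∈ → proj₁ (bounds perm (∈-++⁺ˡ x∈))))
                              | unshift {l} (All.tabulate (λ x∈ → proj₁ (bounds perm (∈-++⁺ʳ M x∈))))
  ... | M′ , refl | l′ , refl = (M′ , l′) , C-shift⁻ k c , refl

-- The enumeration S and pattern containment

-- The underscore stands for the local filter of S, as in ⊛-partial.
mutual
  S-filter : ∀ n → S n ≡ filterᵇ distinct (words n n)
  S-filter n with words n n
  ... | ws = S-filter-go n ws

  S-filter-go : ∀ n ws → _ ≡ filterᵇ distinct ws
  S-filter-go n []       = refl
  S-filter-go n (w ∷ ws) with distinct w
  ... | true  = cong (w ∷_) (S-filter-go n ws)
  ... | false = S-filter-go n ws

count-length : (p : A → Bool) (xs : List A) → count p xs ≡ length (filterᵇ p xs)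
count-length p []       = refl
count-length p (x ∷ xs) with p x
... | true  = cong suc (count-length p xs)
... | false = count-length p xs

concatMap-map : {B D : Set} (f : A → B → D) (xs : List A) (ys : List B) →
  concatMap (λ x → map (f x) ys) xs ≡ cartesianProductWith f xs ys
concatMap-map f []       ys = refl
concatMap-map f (x ∷ xs) ys = cong (map (f x) ys ++_) (concatMap-map f xs ys)

words-suc : ∀ n k → words n (suc k) ≡ cartesianProductWith _∷_ (upTo n) (words n k)
words-suc n k = concatMap-map _∷_ (upTo n) (words n k)

words-unique : ∀ n k → Unique (words n k)
words-unique n zero    = [] ∷ []
words-unique n (suc k) = subst Unique (sym (words-suc n k))
  (Unique.cartesianProductWith⁺ _∷_ (λ { refl → refl , refl }) (Unique.upTo⁺ n) (words-unique n k))

∈-words⁺ : ∀ k → length w ≡ k → All (_< n) w → w ∈ words n k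
∈-words⁺ {[]}        zero    refl []        = here refl
∈-words⁺ {x ∷ w} {n} (suc k) eq   (x< ∷ w<) = subst (x ∷ w ∈_) (sym (words-suc n k))
  (∈-cartesianProductWith⁺ _∷_ (∈-upTo⁺ x<) (∈-words⁺ k (ℕ.suc-injective eq) w<))

∈-words⁻ : ∀ k → w ∈ words n k → length w ≡ k × All (_< n) w
∈-words⁻         zero    (here refl) = refl , []
∈-words⁻ {w} {n} (suc k) w∈ with ∈-cartesianProductWith⁻ _∷_ (upTo n) (words n k) (subst (w ∈_) (words-suc n k) w∈)
... | _ , _ , x∈ , w∈′ , refl = let eq , w< = ∈-words⁻ k w∈′ in cong suc eq , ∈-upTo⁻ x∈ ∷ w<

T-not⁺ : ∀ {b} → ¬ T b → T (not b)
T-not⁺ {true}  ¬t = ⊥-elim (¬t tt)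
T-not⁺ {false} _  = tt

T-not⁻ : ∀ {b} → T (not b) → ¬ T b
T-not⁻ {false} _ ()

distinct⇒Unique : ∀ w → T (distinct w) → Unique w
distinct⇒Unique []      _ = []
distinct⇒Unique (a ∷ w) t = let t₁ , t₂ = Equivalence.to T-∧ t in
  All.map (λ t′ a≡b → T-not⁻ t′ (ℕ.≡⇒≡ᵇ a _ a≡b)) (All.all⁺ _ w t₁) ∷ distinct⇒Unique w t₂

Unique⇒distinct : Unique w → T (distinct w)
Unique⇒distinct []             = tt
Unique⇒distinct {a ∷ w} (a∉ ∷ u) = Equivalence.from T-∧
  (All.all⁻ _ (All.map (λ a≢b → T-not⁺ (a≢b ∘ ℕ.≡ᵇ⇒≡ a _)) a∉) , Unique⇒distinct u)

Perm⇒length : Perm 0 n w → length w ≡ n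
Perm⇒length {n} {w} (mkPerm _ u b f) = trans (ℕ.≤-antisym
  (Unique-length-≤ u (λ x∈ → ∈-upTo⁺ (proj₂ (b x∈))))
  (Unique-length-≤ (Unique.upTo⁺ n) (λ x∈ → f z≤n (∈-upTo⁻ x∈)))) (length-upTo n)

-- By pigeonhole: a missing value `x` together with `w` would give `n + 1` distinct values below
-- `n`.
length⇒Perm : Unique w → All (_< n) w → length w ≡ n → Perm 0 n w
length⇒Perm {w} {n} u w< eq = mkPerm z≤n u (λ x∈ → z≤n , All.lookup w< x∈) λ {x} _ x<n →
  case x ∈? w of λ
  { (yes x∈) → x∈
  ; (no  x∉) → contradiction
      (ℕ.≤-trans (Unique-length-≤ {xs = x ∷ w} (All.tabulate (λ y∈ → λ { refl → x∉ y∈ }) ∷ u)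
                   (λ { (here refl) → ∈-upTo⁺ x<n ; (there y∈) → ∈-upTo⁺ (All.lookup w< y∈) }))
                 (ℕ.≤-reflexive (trans (length-upTo n) (sym eq))))
      ℕ.1+n≰n }
  where open DecMembership ℕ._≟_ using (_∈?_)

∈-S⁺ : Perm 0 n w → w ∈ S n
∈-S⁺ {n} {w} perm = subst (w ∈_) (sym (S-filter n)) (∈-filter⁺ (T? ∘ distinct)
  (∈-words⁺ n (Perm⇒length perm) (All.tabulate (proj₂ ∘ bounds perm))) (Unique⇒distinct (unique perm)))

∈-S⁻ : w ∈ S n → Perm 0 n w
∈-S⁻ {w} {n} w∈ =
  let w∈′ , t = ∈-filter⁻ (T? ∘ distinct) {xs = words n n} (subst (w ∈_) (S-filter n) w∈)
      eq , w< = ∈-words⁻ n w∈′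
  in length⇒Perm (distinct⇒Unique w t) w< eq

∈-subseqs⁺ : ∀ {s} → s ⊆ w → s ∈ subseqs w
∈-subseqs⁺ []         = here refl
∈-subseqs⁺ {a ∷ w} (_ ∷ʳ s)   = ∈-++⁺ʳ (map (a ∷_) (subseqs w)) (∈-subseqs⁺ s)
∈-subseqs⁺ (refl ∷ s) = ∈-++⁺ˡ (∈-map⁺ _ (∈-subseqs⁺ s))

∈-subseqs⁻ : ∀ w {s} → s ∈ subseqs w → s ⊆ w
∈-subseqs⁻ []      (here refl) = []
∈-subseqs⁻ (a ∷ w) s∈ with ∈-++⁻ (map (a ∷_) (subseqs w)) s∈
... | inj₂ s∈′ = a ∷ʳ ∈-subseqs⁻ w s∈′
... | inj₁ s∈′ with ∈-map⁻ (a ∷_) s∈′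
...   | _ , t∈ , refl = refl ∷ ∈-subseqs⁻ w t∈

<⇒<ᵇ≡true : ∀ {a b} → a < b → (a <ᵇ b) ≡ true
<⇒<ᵇ≡true {a} {b} = dec-true (a <? b)

≥⇒<ᵇ≡false : ∀ {a b} → b ≤ a → (a <ᵇ b) ≡ false
≥⇒<ᵇ≡false {a} {b} b≤a = dec-false (a <? b) (ℕ.≤⇒≯ b≤a)

<ᵇ≡true⇒< : ∀ {a b} → (a <ᵇ b) ≡ true → a < b
<ᵇ≡true⇒< {a} eq = ℕ.<ᵇ⇒< a _ (subst T (sym eq) tt)

<ᵇ≡false⇒≥ : ∀ {a b} → (a <ᵇ b) ≡ false → b ≤ a
<ᵇ≡false⇒≥ {a} {b} eq = ℕ.≮⇒≥ λ a<b → subst T eq (ℕ.<⇒<ᵇ a<b)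

-- The test inspects six comparisons, and exactly one combination of outcomes passes; the
-- constructor of `Bad` keeps only those that imply the others.
orderIso-2341⇒Bad : ∀ a b c d → T (orderIso (a ∷ b ∷ c ∷ d ∷ []) (2 ∷ 3 ∷ 4 ∷ 1 ∷ [])) → Bad a b c d
orderIso-2341⇒Bad a b c d t with a <ᵇ b in ab | a <ᵇ c | a <ᵇ d in ad | b <ᵇ c in bc | b <ᵇ d | c <ᵇ d | t
... | true  | true  | false | true  | false | false | _ =
  bad-2341 (<ᵇ≡false⇒≥ ad) (<ᵇ≡true⇒< ab) (<ᵇ≡true⇒< bc)
... | false | _     | _     | _     | _     | _     | ()
... | true  | false | _     | _     | _     | _     | ()
... | true  | true  | true  | _     | _     | _     | ()
... | true  | true  | false | false | _     | _     | ()
... | true  | true  | false | true  | true  | _     | ()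
... | true  | true  | false | true  | false | true  | ()

orderIso-2413⇒Bad : ∀ a b c d → T (orderIso (a ∷ b ∷ c ∷ d ∷ []) (2 ∷ 4 ∷ 1 ∷ 3 ∷ [])) → Bad a b c d
orderIso-2413⇒Bad a b c d t with a <ᵇ b in ab | a <ᵇ c in ac | a <ᵇ d in ad | b <ᵇ c | b <ᵇ d in bd | c <ᵇ d | t
... | true  | false | true  | false | false | true  | _ =
  bad-2413 (<ᵇ≡false⇒≥ ac) (<ᵇ≡true⇒< ab) (<ᵇ≡true⇒< ad) (<ᵇ≡false⇒≥ bd)
... | false | _     | _     | _     | _     | _     | ()
... | true  | true  | _     | _     | _     | _     | ()
... | true  | false | false | _     | _     | _     | ()
... | true  | false | true  | true  | _     | _     | ()
... | true  | false | true  | false | true  | _     | ()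
... | true  | false | true  | false | false | false | ()

orderIso-3412⇒Bad : ∀ a b c d → T (orderIso (a ∷ b ∷ c ∷ d ∷ []) (3 ∷ 4 ∷ 1 ∷ 2 ∷ [])) → Bad a b c d
orderIso-3412⇒Bad a b c d t with a <ᵇ b in ab | a <ᵇ c | a <ᵇ d in ad | b <ᵇ c | b <ᵇ d | c <ᵇ d in cd | t
... | true  | false | false | false | false | true  | _ =
  bad-3412 (<ᵇ≡false⇒≥ ad) (<ᵇ≡true⇒< ab) (<ᵇ≡true⇒< cd)
... | false | _     | _     | _     | _     | _     | ()
... | true  | true  | _     | _     | _     | _     | ()
... | true  | false | true  | _     | _     | _     | ()
... | true  | false | false | true  | _     | _     | ()
... | true  | false | false | false | true  | _     | ()
... | true  | false | false | false | false | false | ()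

-- The comparisons not recorded in `Bad` follow by transitivity, and rewriting with all six makes
-- the test compute to `true`.
Bad⇒orderIso : ∀ {a b c d} → Bad a b c d → Any (λ τ → T (orderIso (a ∷ b ∷ c ∷ d ∷ []) τ)) T₃₃₅
Bad⇒orderIso (bad-2341 d≤a a<b b<c) = here (iso d≤a a<b b<c)
  where
  iso : ∀ {a b c d} → d ≤ a → a < b → b < c → T (orderIso (a ∷ b ∷ c ∷ d ∷ []) (2 ∷ 3 ∷ 4 ∷ 1 ∷ []))
  iso d≤a a<b b<c
    rewrite <⇒<ᵇ≡true a<b | <⇒<ᵇ≡true (ℕ.<-trans a<b b<c) | ≥⇒<ᵇ≡false d≤a | <⇒<ᵇ≡true b<c
          | ≥⇒<ᵇ≡false (ℕ.≤-trans d≤a (ℕ.<⇒≤ a<b)) | ≥⇒<ᵇ≡false (ℕ.≤-trans d≤a (ℕ.<⇒≤ (ℕ.<-trans a<b b<c))) = tt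
Bad⇒orderIso (bad-2413 c≤a a<b a<d d≤b) = there (here (iso c≤a a<b a<d d≤b))
  where
  iso : ∀ {a b c d} → c ≤ a → a < b → a < d → d ≤ b → T (orderIso (a ∷ b ∷ c ∷ d ∷ []) (2 ∷ 4 ∷ 1 ∷ 3 ∷ []))
  iso c≤a a<b a<d d≤b
    rewrite <⇒<ᵇ≡true a<b | ≥⇒<ᵇ≡false c≤a | <⇒<ᵇ≡true a<d | ≥⇒<ᵇ≡false (ℕ.≤-trans c≤a (ℕ.<⇒≤ a<b))
          | ≥⇒<ᵇ≡false d≤b | <⇒<ᵇ≡true (ℕ.≤-<-trans c≤a a<d) = tt
Bad⇒orderIso (bad-3412 d≤a a<b c<d) = there (there (here (iso d≤a a<b c<d)))
  where
  iso : ∀ {a b c d} → d ≤ a → a < b → c < d → T (orderIso (a ∷ b ∷ c ∷ d ∷ []) (3 ∷ 4 ∷ 1 ∷ 2 ∷ []))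
  iso d≤a a<b c<d
    rewrite <⇒<ᵇ≡true a<b | ≥⇒<ᵇ≡false (ℕ.≤-trans (ℕ.<⇒≤ c<d) d≤a) | ≥⇒<ᵇ≡false d≤a
          | ≥⇒<ᵇ≡false (ℕ.≤-trans (ℕ.≤-trans (ℕ.<⇒≤ c<d) d≤a) (ℕ.<⇒≤ a<b))
          | ≥⇒<ᵇ≡false (ℕ.≤-trans d≤a (ℕ.<⇒≤ a<b)) | <⇒<ᵇ≡true c<d = tt

BadWord : List ℕ → Set
BadWord s = ∃₂ λ a b → ∃₂ λ c d → s ≡ a ∷ b ∷ c ∷ d ∷ [] × Bad a b c d

orderIso⇒length : ∀ s t → T (orderIso s t) → length s ≡ length t
orderIso⇒length []      []      _  = refl
orderIso⇒length (_ ∷ s) (_ ∷ t) iso = cong suc (orderIso⇒length s t (proj₂ (Equivalence.to T-∧ iso)))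

length-4 : (s : List ℕ) → length s ≡ 4 → ∃₂ λ a b → ∃₂ λ c d → s ≡ a ∷ b ∷ c ∷ d ∷ []
length-4 (a ∷ b ∷ c ∷ d ∷ []) refl = a , b , c , d , refl

orderIso⇒BadWord : ∀ s {τ} → τ ∈ T₃₃₅ → T (orderIso s τ) → BadWord s
orderIso⇒BadWord s (here refl) iso with length-4 s (orderIso⇒length s (2 ∷ 3 ∷ 4 ∷ 1 ∷ []) iso)
... | a , b , c , d , refl = a , b , c , d , refl , orderIso-2341⇒Bad a b c d iso
orderIso⇒BadWord s (there (here refl)) iso with length-4 s (orderIso⇒length s (2 ∷ 4 ∷ 1 ∷ 3 ∷ []) iso)
... | a , b , c , d , refl = a , b , c , d , refl , orderIso-2413⇒Bad a b c d iso
orderIso⇒BadWord s (there (there (here refl))) iso with length-4 s (orderIso⇒length s (3 ∷ 4 ∷ 1 ∷ 2 ∷ []) iso)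
... | a , b , c , d , refl = a , b , c , d , refl , orderIso-3412⇒Bad a b c d iso

avoidsAll⇒Avoids : ∀ w → T (avoidsAll T₃₃₅ w) → Avoids w
avoidsAll⇒Avoids w t s bad = All.lookupWith
  (λ {τ} avoid iso → T-not⁻ {contains w τ} avoid (Any.any⁺ (λ s → orderIso s τ) (lose (∈-subseqs⁺ s) iso)))
  (All.all⁺ _ T₃₃₅ t) (Bad⇒orderIso bad)

Avoids⇒avoidsAll : Avoids w → T (avoidsAll T₃₃₅ w)
Avoids⇒avoidsAll {w} av = All.all⁻ _ (All.tabulate λ {τ} τ∈ → T-not⁺ {contains w τ} λ t →
  let s , s∈ , iso = find (Any.any⁻ (λ s → orderIso s τ) (subseqs w) t)
      _ , _ , _ , _ , s≡ , bad = orderIso⇒BadWord s τ∈ iso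
  in av (subst (_⊆ w) s≡ (∈-subseqs⁻ w s∈)) bad)

avoiders : ℕ → List (List ℕ)
avoiders n = filterᵇ (avoidsAll T₃₃₅) (S n)

∈-avoiders⁺ : F 0 n w → w ∈ avoiders n
∈-avoiders⁺ (perm , av) = ∈-filter⁺ (T? ∘ avoidsAll T₃₃₅) (∈-S⁺ perm) (Avoids⇒avoidsAll av)

∈-avoiders⁻ : w ∈ avoiders n → F 0 n w
∈-avoiders⁻ {w} {n} w∈ = let w∈S , t = ∈-filter⁻ (T? ∘ avoidsAll T₃₃₅) {xs = S n} w∈ in
  ∈-S⁻ w∈S , avoidsAll⇒Avoids w t

Counts-genFun : Counts F (genFun T₃₃₅)
Counts-genFun = Counts-F λ n → numAvoid T₃₃₅ n , refl , record
  { elems    = avoiders n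
  ; nodup    = Unique.filter⁺ (T? ∘ avoidsAll T₃₃₅) (subst Unique (sym (S-filter n))
                 (Unique.filter⁺ (T? ∘ distinct) (words-unique n n)))
  ; sound    = ∈-avoiders⁻
  ; complete = ∈-avoiders⁺
  ; size     = sym (count-length (avoidsAll T₃₃₅) (S n)) }

-- Existence of the count of pairs, and the cubic

splits : List A → List (List A × List A)
splits []       = ([] , []) ∷ []
splits (x ∷ xs) = ([] , x ∷ xs) ∷ map (λ (ys , zs) → x ∷ ys , zs) (splits xs)

∈-splits : ∀ (xs ys : List A) → (xs , ys) ∈ splits (xs ++ ys)
∈-splits []       []      = here refl
∈-splits []       (_ ∷ _) = here refl
∈-splits (x ∷ xs) ys      = there (∈-map⁺ _ (∈-splits xs ys))

C? : ∀ n z → Dec (C 0 n z)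
C? n (M , l) =
  map′ ∈-avoiders⁻ ∈-avoiders⁺ ((M ++ l) ∈? avoiders n)
  ×-dec ¬? (≡-dec ℕ._≟_ l [])
  ×-dec AllPairs.allPairs? ℕ._>?_ l
  ×-dec AllPairs.allPairs? (λ x y → (x <? y) →-dec All.all? (x <?_) l) M
  where open DecMembership (≡-dec ℕ._≟_) using (_∈?_)

-- A pair in `C 0 n` is an avoider cut in two, so there are finitely many candidates and membership
-- is decidable; this alone defines the coefficients of `Cₛ`.
C-counted : ∀ n → ∃ (Count (C 0 n))
C-counted n = Count-exists (×-≡-dec (≡-dec ℕ._≟_) (≡-dec ℕ._≟_)) (C? n)
  (concatMap splits (avoiders n))
  (λ {(M , l)} (f , _) → ∈-concatMap⁺ splits (lose (∈-avoiders⁺ f) (∈-splits M l)))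

Cₛ : Series
Cₛ n = + proj₁ (C-counted n)

theorem3p35 : let F = genFun T₃₃₅
                  one = const (+ 1)
              in (n : ℕ) → F n ≡ ((one ⊖ X) ⊛ (one ⊖ X)
                                  ⊕ X ⊛ F
                                  ⊕ X ⊛ (const (+ 2) ⊖ const (+ 3) ⊛ X ⊕ const (+ 2) ⊛ X ⊛ X) ⊛ F ⊛ F
                                  ⊖ X ⊛ X ⊛ (one ⊖ X) ⊛ F ⊛ F ⊛ F) n
theorem3p35 = eliminate Fₛ Iₛ Bₛ Cₛ Uₛ (X ⊛ Uₛ)
  (Counts-≈ F countsF (Counts-⇔ (Empty ∪ Image Sum (Ind ⊗ F)) F F-cases⇒F F⇒F-cases
    (Counts-F-cases countsF countsI)))
  (λ n → cong (ℤ._+ Bₛ n) (⊛-comm Fₛ X n))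
  (λ _ → refl)
  (λ n → trans
    (Counts-≈ C countsC (Counts-⇔ C-cases C (λ _ _ → C-compose) (λ _ _ → C-decompose)
      (Counts-C-cases countsC Counts-U countsI countsV)) n)
    (cong (λ t → Uₛ n ℤ.+ t ℤ.+ (Iₛ ⊛ Cₛ) n ℤ.+ Bₛ n) (⊛-comm Cₛ X n)))
  (λ _ → refl)
  Uₛ-equation
  where
  Fₛ Bₛ Iₛ : Series
  Fₛ = genFun T₃₃₅
  Bₛ = Cₛ ⊛ (X ⊛ Uₛ)
  Iₛ = Fₛ ⊛ X ⊕ Bₛ

  countsF : Counts F Fₛ
  countsF = Counts-genFun
  countsC : Counts C Cₛ
  countsC = Counts-C λ n → _ , refl , proj₂ (C-counted n)
  countsV : Counts V (X ⊛ Uₛ)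
  countsV = Counts-⊗ Single U Counts-Single Counts-U
  countsI : Counts Ind Iₛ
  countsI = Counts-Ind countsF (Counts-IndB countsC countsV)
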